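{- Let $F$ be a Boolean formula of size $s$ computing a Boolean function $g$ on $n$ inputs (distributed in any way between Alice and Bob), built from gates $\wedge,\vee,\oplus$ of arbitrary fan-in and additionally Majority gates of arbitrary fan-in, such that every path from the root to a leaf contains at most $O(1)$ Majority gates. Then for every constant $\epsilon>0$, $GH(g)\le O(s^{1+\epsilon})$.
   Context: A Boolean formula is a Boolean circuit in which every gate has fan-out 1 (a tree); its size is its number of leaves. A Majority gate of fan-in $m$ outputs 1 iff at least $m/2$ of its inputs are 1. Garden-hose model: Alice holds her input $x$, Bob holds $y$. A garden-hose protocol of size $s$ consists of a set $V$ of $s$ vertices (pipes) and an extra vertex $t$ (the tap), together with an assignment of a matching $E_A(x)$ on $V\cup\{t\}$ to every input $x$ of Alice and a matching $E_B(y)$ on $V$ to every input $y$ of Bob. In the graph $(V\cup\{t\},E_A(x)\cup E_B(y))$ every vertex has degree at most 2, so there is a unique maximal path starting at $t$; the output on $(x,y)$ is the parity of the number of edges of this path. The protocol computes $g$ if the output equals $g$ for all inputs. $GH(g)$ is the minimum size of a garden-hose protocol computing $g$. -}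

module Defs where

open import Data.Nat using (ℕ; zero; suc; _+_; _*_; _≤_; _⊔_; _≤ᵇ_)
open import Data.Bool using (Bool; true; false; not; _∧_; if_then_else_)
open import Data.Fin using (Fin; zero; suc)
open import Data.Maybe using (Maybe; just; nothing)
open import Data.Sum using (_⊎_; inj₁; inj₂)
open import Data.Product using (Σ; _×_)
open import Relation.Binary.PropositionalEquality using (_≡_; _≢_)

sumFin : (k : ℕ) → (Fin k → ℕ) → ℕ
sumFin zero    f = 0
sumFin (suc k) f = f zero + sumFin k (λ i → f (suc i))

maxFin : (k : ℕ) → (Fin k → ℕ) → ℕ
maxFin zero    f = 0
maxFin (suc k) f = f zero ⊔ maxFin k (λ i → f (suc i))

countTrue : (k : ℕ) → (Fin k → Bool) → ℕ
countTrue k f = sumFin k (λ i → if f i then 1 else 0)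

parity : ℕ → Bool
parity zero    = false
parity (suc n) = not (parity n)

-- Boolean formulas with gates ∧, ∨, ⊕, Maj of arbitrary (positive) fan-in.
-- Leaves are literals: a variable with a polarity (true = x_v, false = ¬x_v).

data GateType : Set where
  AND OR XOR MAJ : GateType

data Formula (V : Set) : Set where
  lit  : V → Bool → Formula V
  gate : GateType → (k : ℕ) → (Fin (suc k) → Formula V) → Formula V

gateEval : GateType → (m : ℕ) → (Fin m → Bool) → Bool
gateEval AND m f = m ≤ᵇ countTrue m f
gateEval OR  m f = 1 ≤ᵇ countTrue m f
gateEval XOR m f = parity (countTrue m f)
gateEval MAJ m f = m ≤ᵇ (2 * countTrue m f)

eval : {V : Set} → Formula V → (V → Bool) → Bool
eval (lit v true)  ρ = ρ v
eval (lit v false) ρ = not (ρ v)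
eval (gate t k c)  ρ = gateEval t (suc k) (λ i → eval (c i) ρ)

size : {V : Set} → Formula V → ℕ
size (lit _ _)    = 1
size (gate _ k c) = sumFin (suc k) (λ i → size (c i))

isMaj : GateType → ℕ
isMaj MAJ = 1
isMaj _   = 0

majDepth : {V : Set} → Formula V → ℕ
majDepth (lit _ _)    = 0
majDepth (gate t k c) = isMaj t + maxFin (suc k) (λ i → majDepth (c i))

-- Garden-hose model.
-- Vertex set Fin (suc s): vertex zero is the tap t, vertices suc i are the s pipes.

record Matching (k : ℕ) : Set where
  field
    partner : Fin k → Maybe (Fin k)
    symm    : ∀ i j → partner i ≡ just j → partner j ≡ just i
    noLoop  : ∀ i → partner i ≢ just i
open Matching public

record GHProtocol (a b s : ℕ) : Set where
  field
    EA     : (Fin a → Bool) → Matching (suc s)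
    EB     : (Fin b → Bool) → Matching (suc s)
    tapFreeB : ∀ y → partner (EB y) zero ≡ nothing
open GHProtocol public

-- Number of edges of the maximal path from the tap in E_A(x) ∪ E_B(y).
-- Every vertex has at most one A-edge and one B-edge, and t only an A-edge,
-- so this path alternates A,B,A,... ; it has at most s edges, so fuel suc s suffices.
walk : {k : ℕ} → Matching k → Matching k → ℕ → Bool → Fin k → ℕ
walk A B zero    _     v = 0
walk A B (suc f) true  v with partner A v
... | nothing = 0
... | just w  = suc (walk A B f false w)
walk A B (suc f) false v with partner B v
... | nothing = 0
... | just w  = suc (walk A B f true w)

output : {a b s : ℕ} → GHProtocol a b s → (Fin a → Bool) → (Fin b → Bool) → Bool
output {s = s} P x y = parity (walk (EA P x) (EB P y) (suc s) true zero)

Computes : {a b s : ℕ} → GHProtocol a b s → ((Fin a → Bool) → (Fin b → Bool) → Bool) → Set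
Computes P g = ∀ x y → output P x y ≡ g x y

GH≤ : {a b : ℕ} → ((Fin a → Bool) → (Fin b → Bool) → Bool) → ℕ → Set
GH≤ {a} {b} g B = Σ ℕ (λ s → s ≤ B × Σ (GHProtocol a b s) (λ P → Computes P g))

fun : {a b : ℕ} → Formula (Fin a ⊎ Fin b) → (Fin a → Bool) → (Fin b → Bool) → Bool
fun F x y = eval F ρ
  where
  ρ : _ → Bool
  ρ (inj₁ i) = x i
  ρ (inj₂ j) = y j

{-# OPTIONS --safe #-}
module Submission where

-- A program is a sequence of permutations of a finite state set W, each selected by one variable. Laying out
-- its steps as levels of |W| pipes gives a garden-hose protocol with O(|W| · length) pipes, so it suffices to
-- find programs of length s^(1+ε) on s^ε states.
--
-- For ∧, ∨, ⊕ (arithmetic over GF(2)) follow Cleve: a polynomial that uses k leaves once each can be computed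
-- in O(k) dirty one-bit registers with only four calls per leaf, whatever k is. Cutting a formula at heavy nodes
-- r times yields a polynomial of bounded size in the coefficients of contexts x ↦ α + β x and in subformulas, all of
-- them smaller by a factor 2^r, with total weight at most doubled; iterating,
-- a formula costs 8^(log s / r) times the total cost of its leaves, on a constant number of states.
--
-- A majority gate is a sign test for z = 2C − k, where C counts the true inputs. Counting modulo p gives z / p
-- modulo 1 exactly, and the partial fractions of m! / (p (p+1) ⋯ (p+m)) combine such counts into approximate
-- rotations by z · m! / (p ⋯ (p+m)) for m = r, …, 0. Each rotation reveals the sign of z or bounds ∣ z ∣ well
-- enough for the next, faster one. With p ≈ s^(1/r) this takes s^O(1/r) states and O_r(1) passes over the inputs,
-- and nesting it d times multiplies these factors.

open import Defs

-- Splitting nests polynomials about (log s) / r deep, and giving every level its own registers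
-- would multiply the number of states each time. Dirty registers remove this: a nested call borrows
-- the registers its caller is still using, so one vector of constant length serves the whole
-- recursion.
--
-- A count modulo p determines z / p only up to whole turns, and p is far too small for the count to
-- hold z itself. Partial fractions still apply because their coefficients are integers: an integer
-- combination of angles known up to whole turns is again known up to whole turns. The slowest
-- rotation stays within a quarter turn for every ∣ z ∣ ≤ s, so there the ambiguity disappears.
--
-- Let L = 2^k with s ≤ L^r ≤ 2^r · s. Each of the d + 1 levels multiplies (length · states) by at
-- most a constant times L^5: L^3 from `8 ^ K`, one L for the counter, one L for the angle. This is
-- what fixes r in terms of d and ε.

module Angles where

  open import Data.Nat as ℕ using (ℕ; zero; suc; _!; _/_; _%_; _<ᵇ_; _≤ᵇ_; _≤?_; _≤_; _<_; _^_; s≤s; z≤n)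
  import Data.Nat.Properties as ℕ
  open import Data.Nat.DivMod using (m≡m%n+[m/n]*n; m%n<n)
  open import Data.Integer using (ℤ; +_; -[1+_]; _⊖_; _+_; _-_; _*_; -_; ∣_∣; 0ℤ; 1ℤ)
  open import Data.Integer.Properties using (pos-+; pos-*; abs-*; ∣i+j∣≤∣i∣+∣j∣; ∣i-j∣≤∣i∣+∣j∣; ∣i∣≡0⇒i≡0;
    [+m]-[+n]≡m⊖n; ∣⊖∣-≤; ∣-i∣≡∣i∣; *-zeroʳ; +-identityʳ; ⊖-<; ⊖-≥)
  open import Data.Integer.Tactic.RingSolver using (solve-∀)
  import Data.Nat.Tactic.RingSolver as ℕ
  open import Data.Bool using (Bool; true; false; if_then_else_; _∧_; _xor_)
  open import Data.Empty using (⊥; ⊥-elim)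
  open import Relation.Nullary using (ofʸ; ofⁿ; yes; no)
  open import Relation.Binary.PropositionalEquality

  -- Approximate rotations proportional to z, and the sign of z

  rising : ℕ → ℕ → ℕ
  rising zero    p = p
  rising (suc m) p = rising m p ℕ.* (p ℕ.+ suc m)

  -- Peels off the smallest factor, where the definition peels off the largest. Together the two
  -- factorisations give the numerator (p + m + 1) - p = m + 1 of the partial fraction.
  rising-suc : ∀ m p → rising (suc m) p ≡ p ℕ.* rising m (suc p)
  rising-suc zero p = cong (p ℕ.*_) (ℕ.+-comm p 1)
  rising-suc (suc m) p = begin
    rising (suc m) p ℕ.* (p ℕ.+ suc (suc m)) ≡⟨ cong₂ ℕ._*_ (rising-suc m p) (ℕ.+-suc p (suc m)) ⟩
    p ℕ.* rising m (suc p) ℕ.* (suc p ℕ.+ suc m) ≡⟨ ℕ.*-assoc p _ _ ⟩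
    p ℕ.* rising (suc m) (suc p) ∎
    where open ≡-Reasoning

  -- a / H lies within e / H of num z / den, modulo 1 (one turn).
  record Approx (H : ℕ) (z : ℤ) (num den e : ℕ) (a : ℤ) : Set where
    field
      turns err : ℤ
      equation  : + den * a + err ≡ + H * (+ num * z + + den * turns)
      err≤      : ∣ err ∣ ℕ.≤ e ℕ.* den
  open Approx

  -- 2 c − k modulo p = suc x, with − k written as k (p − 1) to stay in ℕ.
  residue : ℕ → ℕ → ℕ → ℕ
  residue k x c = (2 ℕ.* c ℕ.+ k ℕ.* x) % suc x

  angle : ℕ → ℕ → ℕ → ℕ → ℕ
  angle H k x c = (H ℕ.* residue k x c) / suc x

  -- Rounding down to a multiple of 1 / H is the only error, and it is below one unit; the residue
  -- determines z / p exactly modulo 1.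
  approx-angle : ∀ H k x C → Approx H (+ 2 * + C - + k) 1 (suc x) 1 (+ angle H k x (C % suc x))
  approx-angle H k x C = record
    -- The three terms are the multiples of p that arise from writing - k as k x = - k + k p, from
    -- reducing C, and from the final reduction.
    { turns = + k - + 2 * + q′ - + q
    ; err = + r
    ; equation = begin
        + p * + a + + r ≡⟨ cong (_+ + r) (sym (pos-* p a)) ⟩
        + (p ℕ.* a) + + r ≡⟨ sym (pos-+ (p ℕ.* a) r) ⟩
        + (p ℕ.* a ℕ.+ r) ≡⟨ cong +_ (trans (cong (ℕ._+ r) (ℕ.*-comm p a)) (trans (ℕ.+-comm _ r) (sym (m≡m%n+[m/n]*n (H ℕ.* ζ) p)))) ⟩
        + (H ℕ.* ζ) ≡⟨ pos-* H ζ ⟩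
        + H * + ζ ≡⟨ cong (λ t → + H * t) ζ-value ⟩
        + H * (+ 1 * (+ 2 * + C - + k) + + p * (+ k - + 2 * + q′ - + q)) ∎
    ; err≤ = subst (r ℕ.≤_) (sym (ℕ.*-identityˡ p)) (ℕ.<⇒≤ (m%n<n (H ℕ.* ζ) p)) }
    where
    open ≡-Reasoning
    p = suc x
    c = C % p
    q′ = C / p
    ζ = residue k x c
    q = (2 ℕ.* c ℕ.+ k ℕ.* x) / p
    a = angle H k x c
    r = (H ℕ.* ζ) % p
    C-split : + C ≡ + c + + q′ * (1ℤ + + x)
    C-split = trans (cong +_ (m≡m%n+[m/n]*n C p)) (trans (pos-+ c (q′ ℕ.* p)) (cong (λ t → + c + t) (pos-* q′ p)))
    ζ-split : + 2 * + c + + k * + x ≡ + ζ + + q * (1ℤ + + x)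
    ζ-split = begin
      + 2 * + c + + k * + x ≡⟨ cong₂ _+_ (sym (pos-* 2 c)) (sym (pos-* k x)) ⟩
      + (2 ℕ.* c) + + (k ℕ.* x) ≡⟨ sym (pos-+ (2 ℕ.* c) (k ℕ.* x)) ⟩
      + (2 ℕ.* c ℕ.+ k ℕ.* x) ≡⟨ cong +_ (m≡m%n+[m/n]*n (2 ℕ.* c ℕ.+ k ℕ.* x) p) ⟩
      + (ζ ℕ.+ q ℕ.* p) ≡⟨ trans (pos-+ ζ (q ℕ.* p)) (cong (λ t → + ζ + t) (pos-* q p)) ⟩
      + ζ + + q * (1ℤ + + x) ∎
    isolate-ζ : ∀ ζ q x → ζ ≡ (ζ + q * (1ℤ + x)) - q * (1ℤ + x)
    isolate-ζ = solve-∀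
    regroup : ∀ c k x q q′ → (+ 2 * c + k * x) - q * (1ℤ + x) ≡
              1ℤ * (+ 2 * (c + q′ * (1ℤ + x)) - k) + (1ℤ + x) * (k - + 2 * q′ - q)
    regroup = solve-∀
    ζ-value : + ζ ≡ + 1 * (+ 2 * + C - + k) + + p * (+ k - + 2 * + q′ - + q)
    ζ-value = begin
      + ζ ≡⟨ isolate-ζ (+ ζ) (+ q) (+ x) ⟩
      (+ ζ + + q * (1ℤ + + x)) - + q * (1ℤ + + x) ≡⟨ cong (_- + q * (1ℤ + + x)) (sym ζ-split) ⟩
      (+ 2 * + c + + k * + x) - + q * (1ℤ + + x) ≡⟨ regroup (+ c) (+ k) (+ x) (+ q) (+ q′) ⟩
      1ℤ * (+ 2 * (+ c + + q′ * (1ℤ + + x)) - + k) + (1ℤ + + x) * (+ k - + 2 * + q′ - + q)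
        ≡⟨ cong (λ t → 1ℤ * (+ 2 * t - + k) + (1ℤ + + x) * (+ k - + 2 * + q′ - + q)) (sym C-split) ⟩
      + 1 * (+ 2 * + C - + k) + + p * (+ k - + 2 * + q′ - + q) ∎

  -- Partial fractions: m! / (p ⋯ (p+m)) − m! / ((p+1) ⋯ (p+m+1)) = (m+1)! / (p ⋯ (p+m+1)).
  angles : ℕ → ℕ → ℕ → ℕ → ℕ → ℕ
  angles h k C zero    x = angle (suc h) k x (C % suc x)
  angles h k C (suc m) x = angles h k C m x ℕ.+ h ℕ.* angles h k C m (suc x)

  -- Modulo `suc h`, multiplication by h is subtraction, at the price of a′ further turns. The two
  -- factorisations of `den″` turn num / den - num / den′ into M · num / den″, and the two errors,
  -- each relative to its own denominator, add up.
  approx-subtract : ∀ {h z num e den den′ den″ a a′} u M → den″ ≡ (u ℕ.+ M) ℕ.* den → den″ ≡ u ℕ.* den′ →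
    Approx (suc h) z num den e (+ a) → Approx (suc h) z num den′ e (+ a′) →
    Approx (suc h) z (M ℕ.* num) den″ (2 ℕ.* e) (+ (a ℕ.+ h ℕ.* a′))
  approx-subtract {h} {z} {num} {e} {den} {den′} {den″} {a} {a′} u M eq eq′ A B = record
    { turns = A .turns - B .turns + + a′
    ; err = + u′ * A .err - + u * B .err
    ; equation = begin
        + den″ * + (a ℕ.+ h ℕ.* a′) + E
          ≡⟨ cong (λ t → + den″ * t + E) (trans (pos-+ a (h ℕ.* a′)) (cong (λ t → + a + t) (pos-* h a′))) ⟩
        + den″ * (+ a + + h * + a′) + E
          ≡⟨ spread (+ den″) (+ a) (+ h) (+ a′) E ⟩
        (+ den″ * + a - + den″ * + a′) + (1ℤ + + h) * (+ den″ * + a′) + E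
          ≡⟨ cong₂ (λ s t → (s * + a - t * + a′) + (1ℤ + + h) * (+ den″ * + a′) + E) D D′ ⟩
        ((+ u + + M) * + den * + a - + u * + den′ * + a′) + (1ℤ + + h) * (+ den″ * + a′) + E
          ≡⟨ cong (λ t → ((+ u + + M) * + den * + a - + u * + den′ * + a′) + (1ℤ + + h) * (+ den″ * + a′)
                         + (t * A .err - + u * B .err)) (pos-+ u M) ⟩
        ((+ u + + M) * + den * + a - + u * + den′ * + a′) + (1ℤ + + h) * (+ den″ * + a′)
          + ((+ u + + M) * A .err - + u * B .err)
          ≡⟨ collect (+ u) (+ M) (+ den) (+ den′) (+ a) (+ a′) ((1ℤ + + h) * (+ den″ * + a′)) (A .err) (B .err) ⟩
        (+ u + + M) * (+ den * + a + A .err) - + u * (+ den′ * + a′ + B .err) + (1ℤ + + h) * (+ den″ * + a′)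
          ≡⟨ cong₂ (λ s t → (+ u + + M) * s - + u * t + (1ℤ + + h) * (+ den″ * + a′)) (A .equation) (B .equation) ⟩
        (+ u + + M) * ((1ℤ + + h) * (+ num * z + + den * A .turns)) - + u * ((1ℤ + + h) * (+ num * z + + den′ * B .turns))
          + (1ℤ + + h) * (+ den″ * + a′)
          ≡⟨ factor (+ u) (+ M) (+ h) (+ num) z (+ den) (+ den′) (A .turns) (B .turns) (+ den″ * + a′) ⟩
        (1ℤ + + h) * (+ M * + num * z + ((+ u + + M) * + den * A .turns - + u * + den′ * B .turns + + den″ * + a′))
          ≡⟨ cong₂ (λ s t → (1ℤ + + h) * (+ M * + num * z + (s * A .turns - t * B .turns + + den″ * + a′))) (sym D) (sym D′) ⟩
        (1ℤ + + h) * (+ M * + num * z + (+ den″ * A .turns - + den″ * B .turns + + den″ * + a′))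
          ≡⟨ cong₂ (λ s t → (1ℤ + + h) * (s * z + t)) (sym (pos-* M num)) (gather (+ den″) (A .turns) (B .turns) (+ a′)) ⟩
        + suc h * (+ (M ℕ.* num) * z + + den″ * (A .turns - B .turns + + a′)) ∎
    ; err≤ = bound }
    where
    open ≡-Reasoning
    u′ = u ℕ.+ M
    E = + u′ * A .err - + u * B .err
    D : + den″ ≡ (+ u + + M) * + den
    D = trans (cong +_ eq) (trans (pos-* u′ den) (cong (_* + den) (pos-+ u M)))
    D′ : + den″ ≡ + u * + den′
    D′ = trans (cong +_ eq′) (pos-* u den′)
    spread : ∀ d a h a′ E → d * (a + h * a′) + E ≡ (d * a - d * a′) + (1ℤ + h) * (d * a′) + E
    spread = solve-∀
    collect : ∀ u M d d′ a a′ X E F → ((u + M) * d * a - u * d′ * a′) + X + ((u + M) * E - u * F) ≡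
              (u + M) * (d * a + E) - u * (d′ * a′ + F) + X
    collect = solve-∀
    factor : ∀ u M h n z d d′ t t′ X →
      (u + M) * ((1ℤ + h) * (n * z + d * t)) - u * ((1ℤ + h) * (n * z + d′ * t′)) + (1ℤ + h) * X ≡
      (1ℤ + h) * (M * n * z + ((u + M) * d * t - u * d′ * t′ + X))
    factor = solve-∀
    gather : ∀ d t t′ a → d * t - d * t′ + d * a ≡ d * (t - t′ + a)
    gather = solve-∀
    bound : ∣ E ∣ ℕ.≤ 2 ℕ.* e ℕ.* den″
    bound = ℕ.≤-trans (∣i-j∣≤∣i∣+∣j∣ (+ u′ * A .err) (+ u * B .err))
      (ℕ.≤-trans (ℕ.≤-reflexive (cong₂ ℕ._+_ (abs-* (+ u′) (A .err)) (abs-* (+ u) (B .err))))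
      (ℕ.≤-trans (ℕ.+-mono-≤ (ℕ.*-monoʳ-≤ u′ (A .err≤)) (ℕ.*-monoʳ-≤ u (B .err≤)))
      (ℕ.≤-reflexive (trans (swap u′ u e den den′)
        (trans (cong₂ (λ s t → e ℕ.* s ℕ.+ e ℕ.* t) (sym eq) (sym eq′)) (twice e den″))))))
      where
      swap : ∀ u′ u e d d′ → u′ ℕ.* (e ℕ.* d) ℕ.+ u ℕ.* (e ℕ.* d′) ≡ e ℕ.* (u′ ℕ.* d) ℕ.+ e ℕ.* (u ℕ.* d′)
      swap = ℕ.solve-∀
      twice : ∀ e d → e ℕ.* d ℕ.+ e ℕ.* d ≡ 2 ℕ.* e ℕ.* d
      twice = ℕ.solve-∀

  -- Reads a residue a < H as a signed angle of at most half a turn, so that its sign can be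
  -- compared with that of z.
  centre : ℕ → ℕ → ℤ
  centre H a = if 2 ℕ.* a <ᵇ H then + a else a ⊖ H

  centre≤ : ∀ H a → a < H → 2 ℕ.* ∣ centre H a ∣ ≤ H
  centre≤ H a a<H with 2 ℕ.* a <ᵇ H | ℕ.<ᵇ-reflects-< (2 ℕ.* a) H
  ... | true | ofʸ lt = ℕ.<⇒≤ lt
  ... | false | ofⁿ ≮ = subst (λ t → 2 ℕ.* t ≤ H) (sym (∣⊖∣-≤ (ℕ.<⇒≤ a<H))) (ℕ.+-cancelʳ-≤ H _ _ le)
    where
    le : 2 ℕ.* (H ℕ.∸ a) ℕ.+ H ≤ H ℕ.+ H
    le = ℕ.≤-trans (ℕ.+-monoʳ-≤ (2 ℕ.* (H ℕ.∸ a)) (ℕ.≮⇒≥ ≮))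
      (ℕ.≤-reflexive (trans (sym (ℕ.*-distribˡ-+ 2 (H ℕ.∸ a) a))
        (trans (cong (2 ℕ.*_) (ℕ.m∸n+n≡m (ℕ.<⇒≤ a<H))) (cong (H ℕ.+_) (ℕ.+-identityʳ H)))))

  approx-shift : ∀ {H z num den e a b} j → b ≡ a - + H * j → Approx H z num den e a → Approx H z num den e b
  approx-shift {H} {z} {num} {den} {e} {a} {b} j eq A = record
    { turns = A .turns - j
    ; err = A .err
    ; equation = begin
        + den * b + A .err ≡⟨ cong (λ t → + den * t + A .err) eq ⟩
        + den * (a - + H * j) + A .err ≡⟨ pull (+ den) a (+ H) j (A .err) ⟩
        (+ den * a + A .err) - + H * (+ den * j) ≡⟨ cong (_- + H * (+ den * j)) (A .equation) ⟩
        + H * (+ num * z + + den * A .turns) - + H * (+ den * j) ≡⟨ push (+ H) (+ num * z) (+ den) (A .turns) j ⟩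
        + H * (+ num * z + + den * (A .turns - j)) ∎
    ; err≤ = A .err≤ }
    where
    open ≡-Reasoning
    pull : ∀ d a h j e → d * (a - h * j) + e ≡ (d * a + e) - h * (d * j)
    pull = solve-∀
    push : ∀ h y d t j → h * (y + d * t) - h * (d * j) ≡ h * (y + d * (t - j))
    push = solve-∀

  division : ∀ W h → + (W % suc h) + + (W / suc h) * + suc h ≡ + W
  division W h = trans (cong (λ t → + (W % suc h) + t) (sym (pos-* (W / suc h) (suc h))))
    (trans (sym (pos-+ (W % suc h) _)) (cong +_ (sym (m≡m%n+[m/n]*n W (suc h)))))

  approx-centre : ∀ {h z num den e} W → Approx (suc h) z num den e (+ W) →
                  Approx (suc h) z num den e (centre (suc h) (W % suc h))
  approx-centre {h} W A with 2 ℕ.* (W % suc h) <ᵇ suc h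
  ... | true = approx-shift (+ (W / suc h)) (trans (drop (+ (W % H)) (+ H) (+ (W / H))) (cong (_- + H * + (W / H)) (division W h))) A
    where
    H = suc h
    drop : ∀ a h q → a ≡ (a + q * h) - h * q
    drop = solve-∀
  ... | false = approx-shift (+ (W / suc h) + 1ℤ) (trans (sym ([+m]-[+n]≡m⊖n (W % H) H))
        (trans (drop (+ (W % H)) (+ H) (+ (W / H))) (cong (_- + H * (+ (W / H) + 1ℤ)) (division W h)))) A
    where
    H = suc h
    drop : ∀ a h q → a - h ≡ (a + q * h) - h * (q + 1ℤ)
    drop = solve-∀

  approx-angles : ∀ h k C m x → Approx (suc h) (+ 2 * + C - + k) (m !) (rising m (suc x)) (2 ^ m) (+ angles h k C m x)
  approx-angles h k C zero    x = approx-angle (suc h) k x C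
  approx-angles h k C (suc m) x = approx-subtract (suc x) (suc m) (ℕ.*-comm (rising m (suc x)) _) (rising-suc m (suc x))
    (approx-angles h k C m x) (approx-angles h k C m (suc x))

  module _ {H : ℕ} {z : ℤ} {num den e : ℕ} {α : ℤ} (A : Approx H z num den e α)
           (0<H : 0 < H) (0<den : 0 < den)
           (α≤ : 2 ℕ.* ∣ α ∣ ≤ H) (e≤ : 8 ℕ.* e ≤ H) (z≤ : 4 ℕ.* num ℕ.* ∣ z ∣ ≤ den) where

    -- In units of a full turn, the angle contributes at most 1/2, the error 1/8 and z itself 1/4.
    -- An integer of absolute value at most 7/8 is 0.
    no-turns : A .turns ≡ 0ℤ
    no-turns = ∣i∣≡0⇒i≡0 (small ∣ A .turns ∣ turns≤)
      where
      isolate : ∀ h y d t → h * (d * t) ≡ h * (y + d * t) - h * y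
      isolate = solve-∀
      abs-eq : H ℕ.* (den ℕ.* ∣ A .turns ∣) ≡ ∣ (+ den * α + A .err) - + H * (+ num * z) ∣
      abs-eq = trans (cong (H ℕ.*_) (sym (abs-* (+ den) (A .turns)))) (trans (sym (abs-* (+ H) (+ den * A .turns)))
        (cong ∣_∣ (trans (isolate (+ H) (+ num * z) (+ den) (A .turns)) (cong (_- + H * (+ num * z)) (sym (A .equation))))))
      abs≤ : H ℕ.* (den ℕ.* ∣ A .turns ∣) ≤ den ℕ.* ∣ α ∣ ℕ.+ e ℕ.* den ℕ.+ H ℕ.* (num ℕ.* ∣ z ∣)
      abs≤ = begin
        H ℕ.* (den ℕ.* ∣ A .turns ∣) ≡⟨ abs-eq ⟩
        ∣ (+ den * α + A .err) - + H * (+ num * z) ∣ ≤⟨ ∣i-j∣≤∣i∣+∣j∣ (+ den * α + A .err) _ ⟩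
        ∣ + den * α + A .err ∣ ℕ.+ ∣ + H * (+ num * z) ∣ ≤⟨ ℕ.+-monoˡ-≤ _ (∣i+j∣≤∣i∣+∣j∣ (+ den * α) (A .err)) ⟩
        ∣ + den * α ∣ ℕ.+ ∣ A .err ∣ ℕ.+ ∣ + H * (+ num * z) ∣
          ≡⟨ cong₂ (λ s t → s ℕ.+ ∣ A .err ∣ ℕ.+ t) (abs-* (+ den) α) (trans (abs-* (+ H) (+ num * z)) (cong (H ℕ.*_) (abs-* (+ num) z))) ⟩
        den ℕ.* ∣ α ∣ ℕ.+ ∣ A .err ∣ ℕ.+ H ℕ.* (num ℕ.* ∣ z ∣)
          ≤⟨ ℕ.+-monoˡ-≤ _ (ℕ.+-monoʳ-≤ (den ℕ.* ∣ α ∣) (A .err≤)) ⟩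
        den ℕ.* ∣ α ∣ ℕ.+ e ℕ.* den ℕ.+ H ℕ.* (num ℕ.* ∣ z ∣) ∎
        where open ℕ.≤-Reasoning
      spread : ∀ d a e h y → 8 ℕ.* (d ℕ.* a ℕ.+ e ℕ.* d ℕ.+ h ℕ.* y) ≡
               4 ℕ.* d ℕ.* (2 ℕ.* a) ℕ.+ d ℕ.* (8 ℕ.* e) ℕ.+ 2 ℕ.* h ℕ.* (4 ℕ.* y)
      spread = ℕ.solve-∀
      sevenths : ∀ d h → 4 ℕ.* d ℕ.* h ℕ.+ d ℕ.* h ℕ.+ 2 ℕ.* h ℕ.* d ≡ 7 ℕ.* (h ℕ.* d)
      sevenths = ℕ.solve-∀
      turns≤ : 8 ℕ.* (H ℕ.* (den ℕ.* ∣ A .turns ∣)) ≤ 7 ℕ.* (H ℕ.* den)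
      turns≤ = begin
        8 ℕ.* (H ℕ.* (den ℕ.* ∣ A .turns ∣)) ≤⟨ ℕ.*-monoʳ-≤ 8 abs≤ ⟩
        8 ℕ.* (den ℕ.* ∣ α ∣ ℕ.+ e ℕ.* den ℕ.+ H ℕ.* (num ℕ.* ∣ z ∣)) ≡⟨ spread den ∣ α ∣ e H (num ℕ.* ∣ z ∣) ⟩
        4 ℕ.* den ℕ.* (2 ℕ.* ∣ α ∣) ℕ.+ den ℕ.* (8 ℕ.* e) ℕ.+ 2 ℕ.* H ℕ.* (4 ℕ.* (num ℕ.* ∣ z ∣))
          ≤⟨ ℕ.+-mono-≤ (ℕ.+-mono-≤ (ℕ.*-monoʳ-≤ (4 ℕ.* den) α≤) (ℕ.*-monoʳ-≤ den e≤))
               (ℕ.*-monoʳ-≤ (2 ℕ.* H) (ℕ.≤-trans (ℕ.≤-reflexive (sym (ℕ.*-assoc 4 num ∣ z ∣))) z≤)) ⟩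
        4 ℕ.* den ℕ.* H ℕ.+ den ℕ.* H ℕ.+ 2 ℕ.* H ℕ.* den ≡⟨ sevenths den H ⟩
        7 ℕ.* (H ℕ.* den) ∎
        where open ℕ.≤-Reasoning
      small : ∀ t → 8 ℕ.* (H ℕ.* (den ℕ.* t)) ≤ 7 ℕ.* (H ℕ.* den) → t ≡ 0
      small zero    _  = refl
      small (suc t) le = ⊥-elim (ℕ.<⇒≱ strict (ℕ.≤-trans (ℕ.*-monoʳ-≤ 8 (ℕ.*-monoʳ-≤ H (ℕ.m≤m*n den (suc t)))) le))
        where
        strict : 7 ℕ.* (H ℕ.* den) < 8 ℕ.* (H ℕ.* den)
        strict = ℕ.m<n+m _ (ℕ.*-mono-< 0<H 0<den)

    linear : + den * α + A .err ≡ + H * (+ num * z)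
    linear = trans (A .equation) (cong (+ H *_) (trans (cong (λ t → + num * z + + den * t) no-turns)
               (trans (cong (λ t → + num * z + t) (*-zeroʳ (+ den))) (+-identityʳ _))))

    -- A rotation that cannot be told from 0 is at most twice the error. This bound on ∣ z ∣ is what
    -- the next stage starts from.
    uncertain⇒ : ∣ α ∣ ≤ e → num ℕ.* ∣ z ∣ ℕ.* H ≤ 2 ℕ.* e ℕ.* den
    uncertain⇒ le = begin
      num ℕ.* ∣ z ∣ ℕ.* H ≡⟨ trans (ℕ.*-comm _ H) (sym (trans (abs-* (+ H) (+ num * z)) (cong (H ℕ.*_) (abs-* (+ num) z)))) ⟩
      ∣ + H * (+ num * z) ∣ ≡⟨ cong ∣_∣ (sym linear) ⟩
      ∣ + den * α + A .err ∣ ≤⟨ ∣i+j∣≤∣i∣+∣j∣ (+ den * α) (A .err) ⟩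
      ∣ + den * α ∣ ℕ.+ ∣ A .err ∣ ≡⟨ cong (ℕ._+ ∣ A .err ∣) (abs-* (+ den) α) ⟩
      den ℕ.* ∣ α ∣ ℕ.+ ∣ A .err ∣ ≤⟨ ℕ.+-mono-≤ (ℕ.*-monoʳ-≤ den le) (A .err≤) ⟩
      den ℕ.* e ℕ.+ e ℕ.* den ≡⟨ twice den e ⟩
      2 ℕ.* e ℕ.* den ∎
      where
      open ℕ.≤-Reasoning
      twice : ∀ d e → d ℕ.* e ℕ.+ e ℕ.* d ≡ 2 ℕ.* e ℕ.* d
      twice = ℕ.solve-∀

  nonneg : ℤ → Bool
  nonneg (+ _)    = true
  nonneg -[1+ _ ] = false

  nonneg-small : ∀ z → (0 < ∣ z ∣ → ⊥) → true ≡ nonneg z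
  nonneg-small (+ _)    _  = refl
  nonneg-small -[1+ _ ] ≡0 = ⊥-elim (≡0 (s≤s z≤n))

  -- Opposite signs would force ∣ err ∣ ≥ den · ∣ α ∣.
  same-sign⁺ : ∀ {H num den e a err} z → 0 < den → e < a → + den * + a + err ≡ + H * (+ num * z) → ∣ err ∣ ≤ e ℕ.* den →
               nonneg z ≡ true
  same-sign⁺ (+ _) _ _ _ _ = refl
  same-sign⁺ {H} {num} {den} {e} {a} {err} -[1+ n ] 0<den e<a eq le = ⊥-elim (ℕ.<⇒≱ big (ℕ.≤-trans (ℕ.≤-reflexive (sym abs-err)) le))
    where
    solved : ∀ d a h n s err → d * a + err ≡ h * (n * - s) → err ≡ - (d * a + h * (n * s))
    solved d a h n s err e = trans (lemma d a err) (trans (cong (_- d * a) e) (lemma′ d a h n s))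
      where
      lemma : ∀ d a err → err ≡ (d * a + err) - d * a
      lemma = solve-∀
      lemma′ : ∀ d a h n s → h * (n * - s) - d * a ≡ - (d * a + h * (n * s))
      lemma′ = solve-∀
    total = den ℕ.* a ℕ.+ H ℕ.* (num ℕ.* suc n)
    cast : + den * + a + + H * (+ num * + suc n) ≡ + total
    cast = trans (cong₂ _+_ (sym (pos-* den a)) (trans (cong (+ H *_) (sym (pos-* num (suc n)))) (sym (pos-* H _)))) (sym (pos-+ (den ℕ.* a) _))
    abs-err : ∣ err ∣ ≡ total
    abs-err = trans (cong ∣_∣ (trans (solved (+ den) (+ a) (+ H) (+ num) (+ suc n) err eq) (cong -_ cast))) (∣-i∣≡∣i∣ (+ total))
    big : e ℕ.* den < total
    big = ℕ.<-≤-trans (ℕ.≤-trans (ℕ.+-monoˡ-≤ (e ℕ.* den) 0<den) (ℕ.≤-trans (ℕ.*-monoˡ-≤ den e<a) (ℕ.≤-reflexive (ℕ.*-comm a den)))) (ℕ.m≤m+n _ _)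

  same-sign⁻ : ∀ {H num den e a err} z → 0 < den → e < suc a → + den * -[1+ a ] + err ≡ + H * (+ num * z) → ∣ err ∣ ≤ e ℕ.* den →
               nonneg z ≡ false
  same-sign⁻ -[1+ _ ] _ _ _ _ = refl
  same-sign⁻ {H} {num} {den} {e} {a} {err} (+ n) 0<den e<a eq le = ⊥-elim (ℕ.<⇒≱ big (ℕ.≤-trans (ℕ.≤-reflexive (sym abs-err)) le))
    where
    solved : ∀ d a h n s err → d * - a + err ≡ h * (n * s) → err ≡ d * a + h * (n * s)
    solved d a h n s err e = trans (lemma d a err) (trans (cong (_+ d * a) e) (lemma′ d a h n s))
      where
      lemma : ∀ d a err → err ≡ (d * - a + err) + d * a
      lemma = solve-∀
      lemma′ : ∀ d a h n s → h * (n * s) + d * a ≡ d * a + h * (n * s)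
      lemma′ = solve-∀
    total = den ℕ.* suc a ℕ.+ H ℕ.* (num ℕ.* n)
    cast : + den * + suc a + + H * (+ num * + n) ≡ + total
    cast = trans (cong₂ _+_ (sym (pos-* den (suc a))) (trans (cong (+ H *_) (sym (pos-* num n))) (sym (pos-* H _)))) (sym (pos-+ (den ℕ.* suc a) _))
    abs-err : ∣ err ∣ ≡ total
    abs-err = cong ∣_∣ (trans (solved (+ den) (+ suc a) (+ H) (+ num) (+ n) err eq) cast)
    big : e ℕ.* den < total
    big = ℕ.<-≤-trans (ℕ.≤-trans (ℕ.+-monoˡ-≤ (e ℕ.* den) 0<den) (ℕ.≤-trans (ℕ.*-monoˡ-≤ den e<a) (ℕ.≤-reflexive (ℕ.*-comm (suc a) den)))) (ℕ.m≤m+n _ _)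

  positive uncertain : ℕ → ℤ → Bool
  positive e (+ a)    = e <ᵇ a
  positive e -[1+ _ ] = false
  uncertain e α = ∣ α ∣ ≤ᵇ e

  -- Stage m finds the sign of z unless ∣ z ∣ is small enough for stage m − 1, where a unit of z turns further;
  -- a z that stays undecided at every stage is 0.
  decide : (ℕ → ℤ) → ℕ → Bool
  decideBelow : (ℕ → ℤ) → ℕ → Bool
  decide α m = positive (2 ^ m) (α m) xor (uncertain (2 ^ m) (α m) ∧ decideBelow α m)
  decideBelow α zero    = true
  decideBelow α (suc m) = decide α m

  0<rising : ∀ m {p} → 0 < p → 0 < rising m p
  0<rising zero    0<p = 0<p
  0<rising (suc m) 0<p = ℕ.*-mono-< (0<rising m 0<p) (ℕ.<-≤-trans 0<p (ℕ.m≤m+n _ _))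

  0<2^ : ∀ m → 0 < 2 ^ m
  0<2^ m = ℕ.m^n>0 2 m

  module _ {H p : ℕ} {z : ℤ} (0<p : 0 < p) (α : ℕ → ℤ)
           (A : ∀ m → Approx H z (m !) (rising m p) (2 ^ m) (α m)) (α≤ : ∀ m → 2 ℕ.* ∣ α m ∣ ≤ H) where

    private
      0<H : ∀ m → 8 ℕ.* (2 ^ m ℕ.* (p ℕ.+ m)) ≤ H → 0 < H
      0<H m = ℕ.≤-trans (ℕ.*-mono-< {0} {8} (s≤s z≤n) (ℕ.*-mono-< (0<2^ m) (ℕ.≤-trans 0<p (ℕ.m≤m+n p m))))

      error≤ : ∀ m → 8 ℕ.* (2 ^ m ℕ.* (p ℕ.+ m)) ≤ H → 8 ℕ.* 2 ^ m ≤ H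
      error≤ m = ℕ.≤-trans (ℕ.*-monoʳ-≤ 8 (ℕ.m≤m*n (2 ^ m) (p ℕ.+ m) ⦃ ℕ.>-nonZero (ℕ.≤-trans 0<p (ℕ.m≤m+n p m)) ⦄))

    -- `positive` and `uncertain` exclude each other, so the xor in `decide` is a case distinction.
    -- The bound on ∣ z ∣ keeps the rotation of stage m within a quarter turn. The bound on H makes
    -- it exceed the error 2^m by a multiple of p + m, the factor by which the denominators of
    -- stages m and m - 1 differ.
    decide-correct : ∀ m → 8 ℕ.* (2 ^ m ℕ.* (p ℕ.+ m)) ≤ H → 4 ℕ.* m ! ℕ.* ∣ z ∣ ≤ rising m p → decide α m ≡ nonneg z
    below-correct : ∀ m → 8 ℕ.* (2 ^ m ℕ.* (p ℕ.+ m)) ≤ H → m ! ℕ.* ∣ z ∣ ℕ.* H ≤ 2 ℕ.* 2 ^ m ℕ.* rising m p →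
                    decideBelow α m ≡ nonneg z

    decide-correct m H≥ z≤ with α m | A m | α≤ m
    ... | + a | Aₘ | αₘ≤ with 2 ^ m <ᵇ a | ℕ.<ᵇ-reflects-< (2 ^ m) a | a ≤ᵇ 2 ^ m | ℕ.≤ᵇ-reflects-≤ a (2 ^ m)
    ...   | true | ofʸ e<a | true | ofʸ a≤e = ⊥-elim (ℕ.<⇒≱ e<a a≤e)
    ...   | false | ofⁿ e≮a | false | ofⁿ a≰e  = ⊥-elim (a≰e (ℕ.≮⇒≥ e≮a))
    ...   | true | ofʸ e<a | false | _ = sym (same-sign⁺ {H} {m !} {rising m p} z (0<rising m 0<p) e<a (linear Aₘ (0<H m H≥) (0<rising m 0<p) αₘ≤ (error≤ m H≥) z≤) (Aₘ .err≤))
    ...   | false | _ | true | ofʸ a≤e = below-correct m H≥ (uncertain⇒ Aₘ (0<H m H≥) (0<rising m 0<p) αₘ≤ (error≤ m H≥) z≤ a≤e)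
    decide-correct m H≥ z≤ | -[1+ a ] | Aₘ | αₘ≤ with suc a ≤ᵇ 2 ^ m | ℕ.≤ᵇ-reflects-≤ (suc a) (2 ^ m)
    ...   | true | ofʸ a≤e = below-correct m H≥ (uncertain⇒ Aₘ (0<H m H≥) (0<rising m 0<p) αₘ≤ (error≤ m H≥) z≤ a≤e)
    ...   | false | ofⁿ a≰e = sym (same-sign⁻ {H} {m !} {rising m p} z (0<rising m 0<p) (ℕ.≰⇒> a≰e) (linear Aₘ (0<H m H≥) (0<rising m 0<p) αₘ≤ (error≤ m H≥) z≤) (Aₘ .err≤))

    -- After stage 0, ∣ z ∣ · H ≤ 2 p while H ≥ 8 p, so only z = 0 is left; this is why the default
    -- of `decideBelow` is `true`.
    below-correct zero H≥ z≤ = nonneg-small z λ 0<z → ℕ.<⇒≱ 2p<8p (ℕ.≤-trans H≥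
        (ℕ.≤-trans (ℕ.m≤n*m H (1 ℕ.* ∣ z ∣) ⦃ ℕ.>-nonZero (ℕ.≤-trans 0<z (ℕ.≤-reflexive (sym (ℕ.*-identityˡ ∣ z ∣)))) ⦄) z≤))
      where
      2p<8p : 2 ℕ.* 1 ℕ.* p < 8 ℕ.* (1 ℕ.* (p ℕ.+ 0))
      2p<8p = subst (2 ℕ.* 1 ℕ.* p <_) (cong (8 ℕ.*_) (sym (trans (ℕ.*-identityˡ _) (ℕ.+-identityʳ p))))
                (ℕ.*-monoˡ-< p ⦃ ℕ.>-nonZero 0<p ⦄ {2} {8} (s≤s (s≤s (s≤s z≤n))))
    below-correct (suc m) H≥ z≤ = decide-correct m
      (ℕ.≤-trans (ℕ.*-monoʳ-≤ 8 (ℕ.*-mono-≤ (ℕ.m≤m+n (2 ^ m) _) (ℕ.+-monoʳ-≤ p (ℕ.n≤1+n m)))) H≥)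
      (ℕ.*-cancelˡ-≤ (2 ℕ.* X) ⦃ ℕ.>-nonZero 0<2X ⦄ bound)
      where
      open ℕ.≤-Reasoning
      -- X collects the error of stage m + 1 and the factor lost in passing to `rising m p`. As H ≥
      -- 8 X, cancelling 2 X leaves exactly the quarter-turn hypothesis of stage m.
      X = 2 ^ suc m ℕ.* (p ℕ.+ suc m)
      0<2X : 0 < 2 ℕ.* X
      0<2X = ℕ.*-mono-< {0} {2} {0} (s≤s z≤n) (ℕ.*-mono-< (0<2^ (suc m)) (ℕ.≤-trans 0<p (ℕ.m≤m+n p _)))
      left : ∀ X f y → 2 ℕ.* X ℕ.* (4 ℕ.* f ℕ.* y) ≡ f ℕ.* y ℕ.* (8 ℕ.* X)
      left = ℕ.solve-∀
      right : ∀ a b c → 2 ℕ.* a ℕ.* (c ℕ.* b) ≡ 2 ℕ.* (a ℕ.* b) ℕ.* c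
      right = ℕ.solve-∀
      bound : 2 ℕ.* X ℕ.* (4 ℕ.* m ! ℕ.* ∣ z ∣) ≤ 2 ℕ.* X ℕ.* rising m p
      bound = begin
        2 ℕ.* X ℕ.* (4 ℕ.* m ! ℕ.* ∣ z ∣) ≡⟨ left X (m !) ∣ z ∣ ⟩
        m ! ℕ.* ∣ z ∣ ℕ.* (8 ℕ.* X) ≤⟨ ℕ.*-mono-≤ (ℕ.*-monoˡ-≤ ∣ z ∣ (ℕ.m≤m+n (m !) (m ℕ.* m !))) H≥ ⟩
        suc m ! ℕ.* ∣ z ∣ ℕ.* H ≤⟨ z≤ ⟩
        2 ℕ.* 2 ^ suc m ℕ.* (rising m p ℕ.* (p ℕ.+ suc m)) ≡⟨ right (2 ^ suc m) (p ℕ.+ suc m) (rising m p) ⟩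
        2 ℕ.* X ℕ.* rising m p ∎

  nonneg-threshold : ∀ C k → nonneg (+ 2 * + C - + k) ≡ (k ≤ᵇ 2 ℕ.* C)
  nonneg-threshold C k rewrite sym (pos-* 2 C) | [+m]-[+n]≡m⊖n (2 ℕ.* C) k with k ≤ᵇ 2 ℕ.* C | ℕ.≤ᵇ-reflects-≤ k (2 ℕ.* C)
  ... | true  | ofʸ le = cong nonneg (⊖-≥ le)
  ... | false | ofⁿ ≰ rewrite ⊖-< (ℕ.≰⇒> ≰) with k ℕ.∸ 2 ℕ.* C | ℕ.m>n⇒m∸n≢0 (ℕ.≰⇒> ≰)
  ...   | zero  | ≢0 = ⊥-elim (≢0 refl)
  ...   | suc _ | _  = refl

  distance≤ : ∀ C k → C ≤ k → ∣ + 2 * + C - + k ∣ ≤ k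
  distance≤ C k C≤k rewrite sym (pos-* 2 C) | [+m]-[+n]≡m⊖n (2 ℕ.* C) k with k ≤? 2 ℕ.* C
  ... | yes le rewrite ⊖-≥ le = ℕ.m≤n+o⇒m∸n≤o (2 ℕ.* C) k (ℕ.+-mono-≤ C≤k (subst (_≤ k) (sym (ℕ.+-identityʳ C)) C≤k))
  ... | no ≰ rewrite ∣⊖∣-≤ (ℕ.<⇒≤ (ℕ.≰⇒> ≰)) = ℕ.m∸n≤m k (2 ℕ.* C)

open Angles

open import Data.Bool using (Bool; true; false; not; _∧_; _xor_; if_then_else_)
open import Data.Bool.Properties using (not-involutive; ∧-zeroʳ; ∧-identityʳ; ∧-assoc; ∧-comm; xor-assoc; xor-comm;
  xor-identityʳ; xor-same; ∧-distribʳ-xor)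
open import Data.Empty using (⊥-elim)
open import Data.Fin using (Fin; zero; suc; toℕ; fromℕ<; splitAt; _↑ˡ_; _↑ʳ_; punchIn; punchOut; inject≤)
open import Data.Fin.Permutation using (transpose)
open import Data.Fin.Properties using (_≟_; *↔×; 2↔Bool; toℕ-fromℕ<; toℕ-injective; suc-injective;
  ↑ˡ-injective; ↑ʳ-injective; splitAt-↑ˡ; splitAt-↑ʳ; punchIn-injective; punchInᵢ≢i; punchIn-punchOut;
  inject≤-injective)
open import Data.Integer using (ℤ)
open import Data.List using (List; []; _∷_; _++_)
open import Data.Maybe as Maybe using (Maybe; just; nothing)
open import Data.Maybe.Properties using (map-∘)
open import Data.Nat using (ℕ; zero; suc; _+_; _*_; _∸_; _^_; _≤_; _<_; _%_; _!; _≤ᵇ_; z≤n; s≤s; _≤?_; _<?_;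
  >-nonZero)
open import Data.Nat.DivMod using (m%n<n; m<n⇒m%n≡m; %-distribˡ-+; m%n%n≡m%n; [m+kn]%n≡m%n)
open import Data.Nat.Properties hiding (_≟_; suc-injective)
open import Data.Nat.Tactic.RingSolver using (solve-∀)
open import Data.Product using (Σ; _×_; _,_; proj₁; proj₂)
open import Data.Product.Function.NonDependent.Propositional using (_×-↔_)
open import Data.Sum using (_⊎_; inj₁; inj₂; [_,_]′)
open import Data.Vec using (Vec; []; _∷_; lookup; zipWith; replicate; _[_]≔_)
open import Data.Vec.Properties using (lookup∘update; lookup∘update′; lookup-zipWith; lookup-replicate;
  tabulate∘lookup; tabulate-cong; zipWith-assoc)
open import Function using (_∘_; id; _↔_; mk↔ₛ′; Inverse)
open import Function.Properties.Inverse using (↔-refl; ↔-sym; ↔-trans)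
open import Relation.Binary.PropositionalEquality
open import Relation.Nullary using (yes; no; ¬_)

open Inverse using (to; from; strictlyInverseˡ; strictlyInverseʳ)

private variable
  A V S Y Z : Set
  n : ℕ

-- Reversible branching programs

-- Only `step` costs length. Permutations that read no variable are absorbed into a neighbouring
-- step by `after`, which makes composition additive in length.
data Program (V S : Set) : Set where
  done : S ↔ S → Program V S
  step : V → (Bool → S ↔ S) → Program V S → Program V S

run : Program V S → (V → Bool) → S → S
run (done π)     ρ s = to π s
run (step v τ P) ρ s = run P ρ (to (τ (ρ v)) s)

len : Program V S → ℕ
len (done _)     = 0
len (step _ _ P) = suc (len P)

after : S ↔ S → Program V S → Program V S
after π (done κ)     = done (↔-trans π κ)
after π (step v τ P) = step v (λ b → ↔-trans π (τ b)) P

infixr 5 _⨾_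

_⨾_ : Program V S → Program V S → Program V S
done π     ⨾ Q = after π Q
step v τ P ⨾ Q = step v τ (P ⨾ Q)

inverse : Program V S → Program V S
inverse (done π)     = done (↔-sym π)
inverse (step v τ P) = inverse P ⨾ step v (↔-sym ∘ τ) (done ↔-refl)

run-⨾ : ∀ (P Q : Program V S) ρ s → run (P ⨾ Q) ρ s ≡ run Q ρ (run P ρ s)
run-⨾ (done π) (done κ)     ρ s = refl
run-⨾ (done π) (step v τ Q) ρ s = refl
run-⨾ (step v τ P) Q        ρ s = run-⨾ P Q ρ _

len-⨾ : ∀ (P Q : Program V S) → len (P ⨾ Q) ≡ len P + len Q
len-⨾ (done π) (done κ)     = refl
len-⨾ (done π) (step v τ Q) = refl
len-⨾ (step v τ P) Q        = cong suc (len-⨾ P Q)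

run-inverse : ∀ (P : Program V S) ρ s → run (inverse P) ρ (run P ρ s) ≡ s
run-inverse (done π)     ρ s = strictlyInverseʳ π s
run-inverse (step v τ P) ρ s
  rewrite run-⨾ (inverse P) (step v (↔-sym ∘ τ) (done ↔-refl)) ρ (run P ρ (to (τ (ρ v)) s))
        | run-inverse P ρ (to (τ (ρ v)) s)
  = strictlyInverseʳ (τ (ρ v)) s

len-inverse : ∀ (P : Program V S) → len (inverse P) ≡ len P
len-inverse (done π) = refl
len-inverse (step v τ P)
  rewrite len-⨾ (inverse P) (step v (↔-sym ∘ τ) (done ↔-refl)) | len-inverse P = +-comm (len P) 1

onFirst : Y ↔ Y → (Y × S) ↔ (Y × S)
onFirst π = π ×-↔ ↔-refl

onSecond : Program V S → Program V (Y × S)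
onSecond (done π)     = done (↔-refl ×-↔ π)
onSecond (step v τ P) = step v (λ b → ↔-refl ×-↔ τ b) (onSecond P)

run-onSecond : ∀ (P : Program V S) ρ (y : Y) s → run (onSecond P) ρ (y , s) ≡ (y , run P ρ s)
run-onSecond (done π)     ρ y s = refl
run-onSecond (step v τ P) ρ y s = run-onSecond P ρ y _

len-onSecond : ∀ {Y : Set} (P : Program V S) → len (onSecond {Y = Y} P) ≡ len P
len-onSecond (done π)     = refl
len-onSecond (step v τ P) = cong suc (len-onSecond P)

controlled : (S → Y ↔ Y) → (Y × S) ↔ (Y × S)
controlled τ = mk↔ₛ′ (λ (y , s) → to (τ s) y , s) (λ (y , s) → from (τ s) y , s)
  (λ (y , s) → cong (_, s) (strictlyInverseˡ (τ s) y))
  (λ (y , s) → cong (_, s) (strictlyInverseʳ (τ s) y))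

record Evaluator {V S Z : Set} (s₀ : S) (g : (V → Bool) → Z) (ℓ : ℕ) : Set where
  field
    prog    : Program V S
    out     : S → Z
    correct : ∀ ρ → out (run prog ρ s₀) ≡ g ρ
    bounded : len prog ≤ ℓ
open Evaluator

record Action {V Y S : Set} (s₀ : S) (h : (V → Bool) → Y → Y) (ℓ : ℕ) : Set where
  field
    prog    : Program V (Y × S)
    correct : ∀ ρ y → run prog ρ (y , s₀) ≡ (h ρ y , s₀)
    bounded : len prog ≤ ℓ

-- Compute, act, uncompute: the workspace returns to s₀, so it can be reused.
act : ∀ {s₀ : S} {g : (V → Bool) → Z} {ℓ} → Evaluator s₀ g ℓ → (τ : Z → Y ↔ Y) →
      Action s₀ (λ ρ → to (τ (g ρ))) (2 * ℓ)
act {V = V} {S} {Y = Y} {s₀} {g} {ℓ} E τ = record { prog = p ; correct = c ; bounded = b }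
  where
  P = E .prog
  mid : Program V (_ × _)
  mid = done (controlled (τ ∘ E .out))
  p = onSecond P ⨾ mid ⨾ onSecond (inverse P)
  c : ∀ ρ y → run p ρ (y , s₀) ≡ (to (τ (g ρ)) y , s₀)
  c ρ y
    rewrite run-⨾ (onSecond P) (mid ⨾ onSecond (inverse P)) ρ (y , s₀)
          | run-⨾ mid (onSecond (inverse P)) ρ (run (onSecond P) ρ (y , s₀))
          | run-onSecond P ρ y s₀
          | E .correct ρ
          | run-onSecond (inverse P) ρ (to (τ (g ρ)) y) (run P ρ s₀)
          | run-inverse P ρ s₀ = refl
  b : len p ≤ 2 * ℓ
  b rewrite len-⨾ (onSecond {Y = Y} P) (mid ⨾ onSecond (inverse P))
          | len-⨾ mid (onSecond (inverse P))
          | len-onSecond {Y = Y} P | len-onSecond {Y = Y} (inverse P) | len-inverse P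
          | +-identityʳ ℓ = +-mono-≤ (E .bounded) (E .bounded)

freely : ∀ {s₀ : S} (π : Y ↔ Y) → Action {V} s₀ (λ _ → to π) 0
freely π = record { prog = done (onFirst π) ; correct = λ _ _ → refl ; bounded = z≤n }

infixr 5 _then_

_then_ : ∀ {s₀ : S} {h h′ : (V → Bool) → Y → Y} {ℓ ℓ′} → Action s₀ h ℓ → Action s₀ h′ ℓ′ →
         Action s₀ (λ ρ → h′ ρ ∘ h ρ) (ℓ + ℓ′)
_then_ {s₀ = s₀} {h} {h′} {ℓ} {ℓ′} A B = record
  { prog = A.prog ⨾ B.prog
  ; correct = λ ρ y → trans (run-⨾ A.prog B.prog ρ (y , s₀))
                     (trans (cong (run B.prog ρ) (A.correct ρ y)) (B.correct ρ (h ρ y)))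
  ; bounded = subst (_≤ ℓ + ℓ′) (sym (len-⨾ A.prog B.prog)) (+-mono-≤ A.bounded B.bounded) }
  where
  module A = Action A
  module B = Action B

recast : ∀ {s₀ : S} {h h′ : (V → Bool) → Y → Y} {ℓ ℓ′} → (∀ ρ y → h ρ y ≡ h′ ρ y) → ℓ ≤ ℓ′ →
         Action s₀ h ℓ → Action s₀ h′ ℓ′
recast {s₀ = s₀} eq le A = record
  { prog = A.prog
  ; correct = λ ρ y → trans (A.correct ρ y) (cong (_, s₀) (eq ρ y))
  ; bounded = ≤-trans A.bounded le }
  where module A = Action A

evaluate : ∀ {s₀ : S} {h : (V → Bool) → Y → Y} {ℓ} (y₀ : Y) (o : Y → Z) → Action s₀ h ℓ →
           Evaluator (y₀ , s₀) (λ ρ → o (h ρ y₀)) ℓ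
evaluate y₀ o A = record
  { prog = A.prog
  ; out = o ∘ proj₁
  ; correct = λ ρ → cong (o ∘ proj₁) (A.correct ρ y₀)
  ; bounded = A.bounded }
  where module A = Action A

withSpare : ∀ {s₀ : S} {g : (V → Bool) → Z} {ℓ} (y₀ : Y) → Evaluator s₀ g ℓ → Evaluator (y₀ , s₀) g ℓ
withSpare {Y = Y} {s₀} {g} {ℓ} y₀ E = record
  { prog = onSecond (E .prog)
  ; out = E .out ∘ proj₂
  ; correct = λ ρ → trans (cong (E .out ∘ proj₂) (run-onSecond (E .prog) ρ y₀ s₀)) (E .correct ρ)
  ; bounded = subst (_≤ ℓ) (sym (len-onSecond (E .prog))) (E .bounded) }

reinterpret : ∀ {s₀ : S} {g : (V → Bool) → Z} {Z′ : Set} {g′ : (V → Bool) → Z′} {ℓ ℓ′} (o : Z → Z′) →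
              (∀ ρ → o (g ρ) ≡ g′ ρ) → ℓ ≤ ℓ′ → Evaluator s₀ g ℓ → Evaluator s₀ g′ ℓ′
reinterpret o eq le E = record
  { prog = E .prog
  ; out = o ∘ E .out
  ; correct = λ ρ → trans (cong o (E .correct ρ)) (eq ρ)
  ; bounded = ≤-trans (E .bounded) le }

-- Garden-hose protocols from programs

-- Level, half and state. Alice's edges join the half `false` to the half `true` of the same level,
-- Bob's join `true` to `false` one level further on, so every step takes one edge of each player.
Vertex : ℕ → Set → Set
Vertex n S = Fin (suc n) × Bool × S

deeper : ∀ {n} → Vertex n S → Vertex (suc n) S
deeper (j , h , s) = (suc j , h , s)

map-just : ∀ {A B : Set} {f : A → B} {y} m → Maybe.map f m ≡ just y → Σ A λ x → m ≡ just x × f x ≡ y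
map-just (just x) refl = x , refl , refl

module _ {V S : Set} (σ : V → (Bool → S ↔ S) → S ↔ S) where

  aliceEdge : (S → Bool) → (P : Program V S) → Vertex (len P) S → Maybe (Vertex (len P) S)
  -- Each earlier level contributes two edges, hence nothing to the parity. One more edge on the
  -- last level, where Bob has none, makes the length odd exactly when the output is 1.
  aliceEdge out (done π) (j , h , s) = if out (to π s) then just (j , not h , s) else nothing
  aliceEdge out (step v τ P) (zero  , false , s) = just (zero , true  , to   (σ v τ) s)
  aliceEdge out (step v τ P) (zero  , true  , s) = just (zero , false , from (σ v τ) s)
  aliceEdge out (step v τ P) (suc j , h     , s) = Maybe.map deeper (aliceEdge out P (j , h , s))

  bobEdge : (P : Program V S) → Vertex (len P) S → Maybe (Vertex (len P) S)
  bobEdge (done π) _ = nothing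
  bobEdge (step v τ P) (zero          , false , s) = nothing
  bobEdge (step v τ P) (zero          , true  , s) = just (suc zero , false , to (σ v τ) s)
  bobEdge (step v τ P) (suc zero      , false , s) = just (zero , true , from (σ v τ) s)
  bobEdge (step v τ P) (suc zero      , true  , s) = Maybe.map deeper (bobEdge P (zero , true , s))
  bobEdge (step v τ P) (suc j@(suc _) , h     , s) = Maybe.map deeper (bobEdge P (j , h , s))

  aliceEdge-symm : ∀ out P u w → aliceEdge out P u ≡ just w → aliceEdge out P w ≡ just u
  aliceEdge-symm out (done π) (zero , false , s) w eq with out (to π s) in o
  aliceEdge-symm out (done π) (zero , false , s) w refl | true rewrite o = refl
  aliceEdge-symm out (done π) (zero , true , s) w eq with out (to π s) in o
  aliceEdge-symm out (done π) (zero , true , s) w refl | true rewrite o = refl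
  aliceEdge-symm out (step v τ P) (zero , false , s) _ refl =
    cong (λ t → just (zero , false , t)) (strictlyInverseʳ (σ v τ) s)
  aliceEdge-symm out (step v τ P) (zero , true , s) _ refl =
    cong (λ t → just (zero , true , t)) (strictlyInverseˡ (σ v τ) s)
  aliceEdge-symm out (step v τ P) (suc j , h , s) w eq with map-just (aliceEdge out P (j , h , s)) eq
  ... | u , e , refl = cong (Maybe.map deeper) (aliceEdge-symm out P _ u e)

  -- A longer program attaches the edge from the level above to this vertex, so within P the vertex
  -- has to be free.
  bobEdge-entry : ∀ P s u → bobEdge P u ≢ just (zero , false , s)
  bobEdge-entry (step v τ P) s (suc zero , true , t) eq with map-just (bobEdge P (zero , true , t)) eq
  ... | _ , _ , ()
  bobEdge-entry (step v τ P) s (suc (suc j) , h , t) eq with map-just (bobEdge P (suc j , h , t)) eq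
  ... | _ , _ , ()

  bobEdge-symm : ∀ P u w → bobEdge P u ≡ just w → bobEdge P w ≡ just u
  bobEdge-symm (step v τ P) (zero , true , s) _ refl =
    cong (λ t → just (zero , true , t)) (strictlyInverseʳ (σ v τ) s)
  bobEdge-symm (step v τ P) (suc zero , false , s) _ refl =
    cong (λ t → just (suc zero , false , t)) (strictlyInverseˡ (σ v τ) s)
  bobEdge-symm (step v τ P) (suc zero , true , s) w eq with map-just (bobEdge P (zero , true , s)) eq
  ... | (zero , false , t) , e , refl = ⊥-elim (bobEdge-entry P t (zero , true , s) e)
  ... | (zero , true , t) , e , refl = cong (Maybe.map deeper) (bobEdge-symm P _ _ e)
  ... | (suc j , h , t) , e , refl = cong (Maybe.map deeper) (bobEdge-symm P _ _ e)
  bobEdge-symm (step v τ P) (suc (suc i) , h′ , s) w eq with map-just (bobEdge P (suc i , h′ , s)) eq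
  ... | (zero , false , t) , e , refl = ⊥-elim (bobEdge-entry P t _ e)
  ... | (zero , true , t) , e , refl = cong (Maybe.map deeper) (bobEdge-symm P _ _ e)
  ... | (suc j , h , t) , e , refl = cong (Maybe.map deeper) (bobEdge-symm P _ _ e)

  aliceEdge-loop : ∀ out P u → aliceEdge out P u ≢ just u
  aliceEdge-loop out (done π) (zero , h , s) eq with out (to π s)
  aliceEdge-loop out (done π) (zero , false , s) () | true
  aliceEdge-loop out (done π) (zero , true , s) () | true
  aliceEdge-loop out (step v τ P) (zero , false , s) ()
  aliceEdge-loop out (step v τ P) (zero , true , s) ()
  aliceEdge-loop out (step v τ P) (suc j , h , s) eq with map-just (aliceEdge out P (j , h , s)) eq
  ... | _ , e , refl = aliceEdge-loop out P _ e

  bobEdge-loop : ∀ P u → bobEdge P u ≢ just u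
  bobEdge-loop (step v τ P) (suc zero , true , s) eq with map-just (bobEdge P (zero , true , s)) eq
  ... | _ , e , refl = bobEdge-loop P _ e
  bobEdge-loop (step v τ P) (suc (suc i) , h , s) eq with map-just (bobEdge P (suc i , h , s)) eq
  ... | _ , e , refl = bobEdge-loop P _ e

transport : ∀ {A : Set} {k} (f : A ↔ Fin k) (e : A → Maybe A) →
            (∀ u w → e u ≡ just w → e w ≡ just u) → (∀ u → e u ≢ just u) → Matching k
transport f e symm noLoop = record
  { partner = λ i → Maybe.map (to f) (e (from f i))
  ; symm = λ i j eq → let (w , p , q) = map-just (e (from f i)) eq in
      trans (cong (λ t → Maybe.map (to f) (e t)) (trans (cong (from f) (sym q)) (strictlyInverseʳ f w)))
     (trans (cong (Maybe.map (to f)) (symm _ w p)) (cong just (strictlyInverseˡ f i)))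
  ; noLoop = λ i eq → let (w , p , q) = map-just (e (from f i)) eq in
      noLoop (from f i) (trans p (cong just (trans (sym (strictlyInverseʳ f w)) (cong (from f) q)))) }

walk-A : ∀ {k} (A B : Matching k) n {v w} → partner A v ≡ just w → walk A B (suc n) true v ≡ suc (walk A B n false w)
walk-A A B n {v} eq with partner A v
walk-A A B n refl | just _ = refl

walk-A-end : ∀ {k} (A B : Matching k) n {v} → partner A v ≡ nothing → walk A B (suc n) true v ≡ 0
walk-A-end A B n {v} eq with partner A v
... | nothing = refl

walk-B : ∀ {k} (A B : Matching k) n {v w} → partner B v ≡ just w → walk A B (suc n) false v ≡ suc (walk A B n true w)
walk-B A B n {v} eq with partner B v
walk-B A B n refl | just _ = refl

walk-B-end : ∀ {k} (A B : Matching k) n {v} → partner B v ≡ nothing → walk A B (suc n) false v ≡ 0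
walk-B-end A B n {v} eq with partner B v
... | nothing = refl

module _ {V S : Set} (σA σB : V → (Bool → S ↔ S) → S ↔ S) (ρ : V → Bool) (out : S → Bool)
         (split : ∀ v τ s → to (σB v τ) (to (σA v τ) s) ≡ to (τ (ρ v)) s) where

  -- Bob's edge at the entry level is exempt: there the ambient graph continues upwards.
  walk-program : ∀ {k} (A B : Matching k) P (φ : Vertex (len P) S → Fin k) →
    (∀ u → partner A (φ u) ≡ Maybe.map φ (aliceEdge σA out P u)) →
    (∀ s → partner B (φ (zero , true , s)) ≡ Maybe.map φ (bobEdge σB P (zero , true , s))) →
    (∀ j h s → partner B (φ (suc j , h , s)) ≡ Maybe.map φ (bobEdge σB P (suc j , h , s))) →
    ∀ n s → parity (walk A B (2 + (len P * 2 + n)) true (φ (zero , false , s))) ≡ out (run P ρ s)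
  walk-program A B (done π) φ hA hB hB′ n s with out (to π s) in o
  ... | false = cong parity (walk-A-end A B (suc n) (trans (hA _) (cong (Maybe.map φ) e)))
    where e : aliceEdge σA out (done π) (zero , false , s) ≡ nothing
          e rewrite o = refl
  ... | true = cong parity (trans (walk-A A B (suc n) (trans (hA _) (cong (Maybe.map φ) e)))
                                  (cong suc (walk-B-end A B n (hB s))))
    where e : aliceEdge σA out (done π) (zero , false , s) ≡ just (zero , true , s)
          e rewrite o = refl
  walk-program A B (step v τ P) φ hA hB hB′ n s = begin
    parity (walk A B (4 + (len P * 2 + n)) true (φ (zero , false , s)))
      ≡⟨ cong parity (walk-A A B _ (hA _)) ⟩
    parity (suc (walk A B (3 + (len P * 2 + n)) false _))
      ≡⟨ cong (parity ∘ suc) (walk-B A B _ (hB _)) ⟩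
    parity (suc (suc (walk A B (2 + (len P * 2 + n)) true _)))
      ≡⟨ not-involutive _ ⟩
    parity (walk A B (2 + (len P * 2 + n)) true (φ (suc zero , false , to (σB v τ) (to (σA v τ) s))))
      ≡⟨ walk-program A B P (φ ∘ deeper)
           (λ u → trans (hA (deeper u)) (sym (map-∘ (aliceEdge σA out P u))))
           (λ t → trans (hB′ zero true t) (sym (map-∘ (bobEdge σB P (zero , true , t)))))
           (λ j h t → trans (hB′ (suc j) h t) (sym (map-∘ (bobEdge σB P (suc j , h , t))))) n _ ⟩
    out (run P ρ (to (σB v τ) (to (σA v τ) s)))
      ≡⟨ cong (out ∘ run P ρ) (split v τ s) ⟩
    out (run P ρ (to (τ (ρ v)) s)) ∎
    where open ≡-Reasoning

-- The owner of the variable applies the selected permutation and the other player the identity; the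
-- composite is the right permutation although each edge depends on one input only.
aliceTurn : ∀ {a b} → (Fin a → Bool) → Fin a ⊎ Fin b → (Bool → S ↔ S) → S ↔ S
aliceTurn x (inj₁ i) τ = τ (x i)
aliceTurn x (inj₂ j) τ = ↔-refl

bobTurn : ∀ {a b} → (Fin b → Bool) → Fin a ⊎ Fin b → (Bool → S ↔ S) → S ↔ S
bobTurn y (inj₁ i) τ = ↔-refl
bobTurn y (inj₂ j) τ = τ (y j)

turns : ∀ {a b} (x : Fin a → Bool) (y : Fin b → Bool) v (τ : Bool → S ↔ S) s →
        to (bobTurn y v τ) (to (aliceTurn x v τ) s) ≡ to (τ ([ x , y ]′ v)) s
turns x y (inj₁ i) τ s = refl
turns x y (inj₂ j) τ s = refl

bobEdge-tap : ∀ (σ : V → (Bool → S ↔ S) → S ↔ S) P s → bobEdge σ P (zero , false , s) ≡ nothing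
bobEdge-tap σ (done π)     s = refl
bobEdge-tap σ (step v τ P) s = refl

fuel-identity : ∀ W n → suc (W + (suc W + 0) + n * (2 * suc W)) ≡ 2 + (n * 2 + (2 * W + n * (2 * W)))
fuel-identity = solve-∀

protocol : ∀ {a b W} {s₀ : S} {g : (Fin a ⊎ Fin b → Bool) → Bool} {ℓ} →
           S ↔ Fin W → Evaluator s₀ g ℓ → GH≤ (λ x y → g [ x , y ]′) (suc ℓ * (2 * W))
protocol {W = zero} {s₀} β E with () ← to β s₀
protocol {S} {a} {b} {suc W} {s₀} {g} {ℓ} β E =
  pipes , ≤-trans (n≤1+n pipes) (*-monoˡ-≤ (2 * suc W) (s≤s (E .bounded))) , π , computes
  where
  P = E .prog
  depth : ℕ
  depth = len P
  pipes : ℕ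
  -- All vertices except the tap, written so that `suc pipes` reduces to `suc depth * (2 * suc W)`,
  -- the size of the encoding.
  pipes = W + (suc W + 0) + depth * (2 * suc W)
  β₀ : S ↔ Fin (suc W)
  -- The tap is vertex `zero`, so the states are renumbered to give s₀ the number 0.
  β₀ = ↔-trans β (transpose (to β s₀) zero)
  β₀-start : to β₀ s₀ ≡ zero
  β₀-start with to β s₀ ≟ to β s₀
  ... | yes _ = refl
  ... | no ≢  = ⊥-elim (≢ refl)
  enc : Vertex depth S ↔ Fin (suc pipes)
  enc = ↔-sym (↔-trans *↔× (↔-refl ×-↔ ↔-trans *↔× (2↔Bool ×-↔ ↔-sym β₀)))
  enc-start : to enc (zero , false , s₀) ≡ zero
  enc-start rewrite β₀-start = refl
  dec-start : from enc zero ≡ (zero , false , s₀)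
  dec-start = trans (cong (from enc) (sym enc-start)) (strictlyInverseʳ enc _)
  alice : (Fin a → Bool) → Matching (suc pipes)
  alice x = transport enc (aliceEdge (aliceTurn x) (E .out) P)
          (aliceEdge-symm (aliceTurn x) (E .out) P) (aliceEdge-loop (aliceTurn x) (E .out) P)
  bob : (Fin b → Bool) → Matching (suc pipes)
  bob y = transport enc (bobEdge (bobTurn y) P) (bobEdge-symm (bobTurn y) P) (bobEdge-loop (bobTurn y) P)
  π : GHProtocol a b pipes
  π = record
    { EA = alice ; EB = bob
    ; tapFreeB = λ y → cong (Maybe.map (to enc))
        (trans (cong (bobEdge (bobTurn y) P) dec-start) (bobEdge-tap (bobTurn y) P s₀)) }
  fuel : Σ ℕ λ e → suc pipes ≡ 2 + (depth * 2 + e)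
  fuel = 2 * W + depth * (2 * W) , fuel-identity W depth
  computes : Computes π (λ x y → g [ x , y ]′)
  computes x y = begin
    parity (walk (alice x) (bob y) (suc pipes) true zero)
      ≡⟨ cong₂ (λ f v → parity (walk (alice x) (bob y) f true v)) (fuel .proj₂) (sym enc-start) ⟩
    parity (walk (alice x) (bob y) (2 + (depth * 2 + fuel .proj₁)) true (to enc (zero , false , s₀)))
      ≡⟨ walk-program (aliceTurn x) (bobTurn y) [ x , y ]′ (E .out) (turns x y) (alice x) (bob y) P (to enc)
           (λ u → cong (λ t → Maybe.map (to enc) (aliceEdge (aliceTurn x) (E .out) P t)) (strictlyInverseʳ enc u))
           (λ s → cong (λ t → Maybe.map (to enc) (bobEdge (bobTurn y) P t)) (strictlyInverseʳ enc (zero , true , s)))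
           (λ j h s → cong (λ t → Maybe.map (to enc) (bobEdge (bobTurn y) P t)) (strictlyInverseʳ enc (suc j , h , s)))
           (fuel .proj₁) s₀ ⟩
    E .out (run P [ x , y ]′ s₀)
      ≡⟨ E .correct [ x , y ]′ ⟩
    g [ x , y ]′ ∎
    where open ≡-Reasoning

-- Bit vectors and elementary additions over GF(2)

infixl 6 _⊕_

_⊕_ : Vec Bool n → Vec Bool n → Vec Bool n
_⊕_ = zipWith _xor_

unit : Fin n → Bool → Vec Bool n
unit i c = replicate _ false [ i ]≔ c

lookup-⊕ : ∀ (x y : Vec Bool n) k → lookup (x ⊕ y) k ≡ lookup x k xor lookup y k
lookup-⊕ x y k = lookup-zipWith _xor_ k x y

lookup-unit : ∀ (i : Fin n) c → lookup (unit i c) i ≡ c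
lookup-unit i c = lookup∘update i (replicate _ false) c

lookup-unit′ : ∀ {i k : Fin n} c → k ≢ i → lookup (unit i c) k ≡ false
lookup-unit′ {k = k} c k≢i = trans (lookup∘update′ k≢i (replicate _ false) c) (lookup-replicate k false)

lookup-ext : ∀ {x y : Vec Bool n} → (∀ k → lookup x k ≡ lookup y k) → x ≡ y
lookup-ext {x = x} {y} eq = trans (sym (tabulate∘lookup x)) (trans (tabulate-cong eq) (tabulate∘lookup y))

⊕-identityʳ : ∀ (x : Vec Bool n) i → x ⊕ unit i false ≡ x
⊕-identityʳ x i = lookup-ext λ k → trans (lookup-⊕ x (unit i false) k)
  (trans (cong (lookup x k xor_) (zeros k)) (xor-identityʳ _))
  where
  zeros : ∀ k → lookup (unit i false) k ≡ false
  zeros k with k ≟ i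
  ... | yes refl = lookup-unit i false
  ... | no k≢i = lookup-unit′ false k≢i

unit-xor : ∀ (i : Fin n) c d → unit i (c xor d) ≡ unit i c ⊕ unit i d
unit-xor i c d = lookup-ext λ k → trans (pointwise k) (sym (lookup-⊕ (unit i c) (unit i d) k))
  where
  pointwise : ∀ k → lookup (unit i (c xor d)) k ≡ lookup (unit i c) k xor lookup (unit i d) k
  pointwise k with k ≟ i
  ... | yes refl = trans (lookup-unit i (c xor d)) (sym (cong₂ _xor_ (lookup-unit i c) (lookup-unit i d)))
  ... | no k≢i = trans (lookup-unit′ _ k≢i) (sym (cong₂ _xor_ (lookup-unit′ c k≢i) (lookup-unit′ d k≢i)))

⊕-interchange : ∀ (x y z w : Vec Bool n) → (x ⊕ y) ⊕ (z ⊕ w) ≡ (x ⊕ z) ⊕ (y ⊕ w)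
⊕-interchange [] [] [] [] = refl
⊕-interchange (x ∷ xs) (y ∷ ys) (z ∷ zs) (w ∷ ws) = cong₂ _∷_ (bits x y z w) (⊕-interchange xs ys zs ws)
  where
  bits : ∀ x y z w → (x xor y) xor (z xor w) ≡ (x xor z) xor (y xor w)
  bits false false z w = refl
  bits false true false w = refl
  bits false true true w = refl
  bits true false false w = refl
  bits true false true false = refl
  bits true false true true = refl
  bits true true false false = refl
  bits true true false true = refl
  bits true true true w = refl

-- The elementary matrix (transvection) adding b times coordinate j to coordinate i.
addTo : Fin n → Fin n → Bool → Vec Bool n → Vec Bool n
addTo i j b x = x ⊕ unit i (b ∧ lookup x j)

addTo-target : ∀ (i j : Fin n) b x → lookup (addTo i j b x) i ≡ lookup x i xor (b ∧ lookup x j)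
addTo-target i j b x = trans (lookup-⊕ x _ i) (cong (lookup x i xor_) (lookup-unit i _))

addTo-other : ∀ {i k : Fin n} j b x → k ≢ i → lookup (addTo i j b x) k ≡ lookup x k
addTo-other j b x k≢i =
  trans (lookup-⊕ x _ _) (trans (cong (lookup x _ xor_) (lookup-unit′ _ k≢i)) (xor-identityʳ _))

addTo-additive : ∀ (i j : Fin n) b x y → addTo i j b (x ⊕ y) ≡ addTo i j b x ⊕ addTo i j b y
addTo-additive i j b x y = trans
  (cong (x ⊕ y ⊕_) (trans (cong (unit i) (trans (cong (b ∧_) (lookup-⊕ x y j)) (distrib b _ _))) (unit-xor i _ _)))
  (⊕-interchange x y _ _)
  where
  distrib : ∀ b c d → b ∧ (c xor d) ≡ (b ∧ c) xor (b ∧ d)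
  distrib false c d = refl
  distrib true c d = refl

addTo-idle : ∀ (i j : Fin n) b x → lookup x j ≡ false → addTo i j b x ≡ x
addTo-idle i j b x xⱼ≡0 =
  trans (cong (λ c → x ⊕ unit i c) (trans (cong (b ∧_) xⱼ≡0) (∧-zeroʳ b))) (⊕-identityʳ x i)

addTo-involutive : ∀ {i j : Fin n} → i ≢ j → ∀ b x → addTo i j b (addTo i j b x) ≡ x
addTo-involutive {i = i} {j} i≢j b x = lookup-ext pointwise
  where
  cancel : ∀ c d → (c xor d) xor d ≡ c
  cancel c d = trans (xor-assoc c d d) (trans (cong (c xor_) (xor-same d)) (xor-identityʳ c))
  pointwise : ∀ k → lookup (addTo i j b (addTo i j b x)) k ≡ lookup x k
  pointwise k with k ≟ i
  ... | no k≢i = trans (addTo-other j b (addTo i j b x) k≢i) (addTo-other j b x k≢i)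
  ... | yes refl = trans (addTo-target i j b (addTo i j b x)) (trans
    (cong₂ (λ c d → c xor (b ∧ d)) (addTo-target i j b x) (addTo-other {i = i} j b x (i≢j ∘ sym)))
    (cancel (lookup x i) _))

addPerm : ∀ {i j : Fin n} → i ≢ j → Bool → Vec Bool n ↔ Vec Bool n
addPerm {i = i} {j} i≢j b =
  mk↔ₛ′ (addTo i j b) (addTo i j b) (addTo-involutive i≢j b) (addTo-involutive i≢j b)

-- Polynomials over GF(2) evaluated in dirty registers

data Poly (A : Set) : Set where
  leaf    : A → Poly A
  const   : Bool → Poly A
  add mul : Poly A → Poly A → Poly A

⟦_⟧ : ∀ {A} → Poly A → (A → Bool) → Bool
⟦ leaf a ⟧    v = v a
⟦ const b ⟧   v = b
⟦ add Φ Ψ ⟧ v = ⟦ Φ ⟧ v xor ⟦ Ψ ⟧ v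
⟦ mul Φ Ψ ⟧ v = ⟦ Φ ⟧ v ∧ ⟦ Ψ ⟧ v

weight : ∀ {A} → (A → ℕ) → Poly A → ℕ
weight w (leaf a)  = w a
weight w (const b) = 0
weight w (add Φ Ψ) = weight w Φ + weight w Ψ
weight w (mul Φ Ψ) = weight w Φ + weight w Ψ

-- The number of scratch registers: a product needs one for its intermediate result, while both
-- summands of a sum go straight to the same target.
muls : ∀ {A} → Poly A → ℕ
muls (leaf a)  = 0
muls (const b) = 0
muls (add Φ Ψ) = muls Φ + muls Ψ
muls (mul Φ Ψ) = suc (muls Φ + muls Ψ)

record Layout {k} (s t : Fin n) (ν : Fin k → Fin n) : Set where
  field
    s≢t : s ≢ t
    ν≢s : ∀ a → ν a ≢ s
    ν≢t : ∀ a → ν a ≢ t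
    inj : ∀ {a b} → ν a ≡ ν b → a ≡ b
open Layout

↑ˡ≢↑ʳ : ∀ {m k} (a : Fin m) (b : Fin k) → a ↑ˡ k ≢ m ↑ʳ b
↑ˡ≢↑ʳ {m} {k} a b eq with trans (sym (splitAt-↑ˡ m a k)) (trans (cong (splitAt m) eq) (splitAt-↑ʳ m k b))
... | ()

module _ {m k : ℕ} {s t : Fin n} where

  add-left : {ν : Fin (m + k) → Fin n} → Layout s t ν → Layout s t (ν ∘ (_↑ˡ k))
  add-left Λ = record { s≢t = Λ .s≢t ; ν≢s = λ a → Λ .ν≢s _ ; ν≢t = λ a → Λ .ν≢t _
                      ; inj = λ e → ↑ˡ-injective k _ _ (Λ .inj e) }

  add-right : {ν : Fin (m + k) → Fin n} → Layout s t ν → Layout s t (ν ∘ (m ↑ʳ_))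
  add-right Λ = record { s≢t = Λ .s≢t ; ν≢s = λ a → Λ .ν≢s _ ; ν≢t = λ a → Λ .ν≢t _
                       ; inj = λ e → ↑ʳ-injective m _ _ (Λ .inj e) }

  mul-left : {ν : Fin (suc (m + k)) → Fin n} → Layout s t ν → Layout s (ν zero) (ν ∘ suc ∘ (_↑ˡ k))
  mul-left Λ = record { s≢t = Λ .ν≢s zero ∘ sym ; ν≢s = λ a → Λ .ν≢s _
                      ; ν≢t = λ a e → 0≢suc (Λ .inj (sym e))
                      ; inj = λ e → ↑ˡ-injective k _ _ (suc-injective (Λ .inj e)) }
    where 0≢suc : ∀ {j} {a : Fin j} → zero ≢ suc a
          0≢suc ()

  mul-right : {ν : Fin (suc (m + k)) → Fin n} → Layout s t ν → Layout (ν zero) t (ν ∘ suc ∘ (m ↑ʳ_))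
  mul-right Λ = record { s≢t = Λ .ν≢t zero ; ν≢s = λ a e → 0≢suc (Λ .inj (sym e))
                       ; ν≢t = λ a → Λ .ν≢t _
                       ; inj = λ e → ↑ʳ-injective m _ _ (suc-injective (Λ .inj e)) }
    where 0≢suc : ∀ {j} {a : Fin j} → zero ≢ suc a
          0≢suc ()

module _ {A : Set} where

  -- Adds Φ times register s to register t when the scratch registers ν are zero; leaves garbage in ν.
  forward backward : (Φ : Poly A) (s t : Fin n) → (Fin (muls Φ) → Fin n) → (A → Bool) → Vec Bool n → Vec Bool n
  forward (leaf a)  s t ν v = addTo t s (v a)
  forward (const b) s t ν v = addTo t s b
  forward (add Φ Ψ) s t ν v = forward Ψ s t (ν ∘ (muls Φ ↑ʳ_)) v ∘ forward Φ s t (ν ∘ (_↑ˡ muls Ψ)) v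
  forward (mul Φ Ψ) s t ν v =
    forward Ψ (ν zero) t (ν ∘ suc ∘ (muls Φ ↑ʳ_)) v ∘ forward Φ s (ν zero) (ν ∘ suc ∘ (_↑ˡ muls Ψ)) v
  backward (leaf a)  s t ν v = addTo t s (v a)
  backward (const b) s t ν v = addTo t s b
  backward (add Φ Ψ) s t ν v = backward Φ s t (ν ∘ (_↑ˡ muls Ψ)) v ∘ backward Ψ s t (ν ∘ (muls Φ ↑ʳ_)) v
  backward (mul Φ Ψ) s t ν v =
    backward Φ s (ν zero) (ν ∘ suc ∘ (_↑ˡ muls Ψ)) v ∘ backward Ψ (ν zero) t (ν ∘ suc ∘ (muls Φ ↑ʳ_)) v

  -- Every step is an elementary matrix whose coefficient depends on v only. This linearity is what
  -- makes dirty registers harmless.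
  forward-additive : ∀ Φ (s t : Fin n) ν v x y →
    forward Φ s t ν v (x ⊕ y) ≡ forward Φ s t ν v x ⊕ forward Φ s t ν v y
  forward-additive (leaf a)  s t ν v x y = addTo-additive t s (v a) x y
  forward-additive (const b) s t ν v x y = addTo-additive t s b x y
  forward-additive (add Φ Ψ) s t ν v x y =
    trans (cong (forward Ψ s t _ v) (forward-additive Φ s t _ v x y)) (forward-additive Ψ s t _ v _ _)
  forward-additive (mul Φ Ψ) s t ν v x y =
    trans (cong (forward Ψ _ t _ v) (forward-additive Φ s _ _ v x y)) (forward-additive Ψ _ t _ v _ _)

  backward-forward : ∀ Φ {s t : Fin n} {ν} → Layout s t ν → ∀ v x → backward Φ s t ν v (forward Φ s t ν v x) ≡ x
  backward-forward (leaf a)  Λ v x = addTo-involutive (Λ .s≢t ∘ sym) (v a) x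
  backward-forward (const b) Λ v x = addTo-involutive (Λ .s≢t ∘ sym) b x
  backward-forward (add Φ Ψ) Λ v x =
    trans (cong (backward Φ _ _ _ v) (backward-forward Ψ (add-right {m = muls Φ} Λ) v _))
          (backward-forward Φ (add-left {m = muls Φ} Λ) v x)
  backward-forward (mul Φ Ψ) Λ v x =
    trans (cong (backward Φ _ _ _ v) (backward-forward Ψ (mul-right {m = muls Φ} Λ) v _))
          (backward-forward Φ (mul-left {m = muls Φ} Λ) v x)

  forward-other : ∀ Φ (s t : Fin n) ν v x k → k ≢ t → (∀ a → k ≢ ν a) →
    lookup (forward Φ s t ν v x) k ≡ lookup x k
  forward-other (leaf a)  s t ν v x k k≢t k∉ν = addTo-other s (v a) x k≢t
  forward-other (const b) s t ν v x k k≢t k∉ν = addTo-other s b x k≢t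
  forward-other (add Φ Ψ) s t ν v x k k≢t k∉ν =
    trans (forward-other Ψ s t _ v _ k k≢t (k∉ν ∘ _)) (forward-other Φ s t _ v x k k≢t (k∉ν ∘ _))
  forward-other (mul Φ Ψ) s t ν v x k k≢t k∉ν =
    trans (forward-other Ψ _ t _ v _ k k≢t (k∉ν ∘ _)) (forward-other Φ s _ _ v x k (k∉ν zero) (k∉ν ∘ _))

  forward-idle : ∀ Φ (s t : Fin n) ν v x → lookup x s ≡ false → (∀ a → lookup x (ν a) ≡ false) →
    forward Φ s t ν v x ≡ x
  forward-idle (leaf a)  s t ν v x xₛ≡0 _ = addTo-idle t s (v a) x xₛ≡0
  forward-idle (const b) s t ν v x xₛ≡0 _ = addTo-idle t s b x xₛ≡0
  forward-idle (add Φ Ψ) s t ν v x xₛ≡0 z =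
    trans (cong (forward Ψ s t _ v) (forward-idle Φ s t _ v x xₛ≡0 (z ∘ _))) (forward-idle Ψ s t _ v x xₛ≡0 (z ∘ _))
  forward-idle (mul Φ Ψ) s t ν v x xₛ≡0 z =
    trans (cong (forward Ψ _ t _ v) (forward-idle Φ s _ _ v x xₛ≡0 (z ∘ _)))
          (forward-idle Ψ _ t _ v x (z zero) (z ∘ _))

  -- Clean scratch registers are assumed here, but in the end the lemma is applied only to a vector
  -- supported on register s, never to the actual contents; linearity transfers the result.
  forward-target : ∀ Φ {s t : Fin n} {ν} → Layout s t ν → ∀ v x → (∀ a → lookup x (ν a) ≡ false) →
    lookup (forward Φ s t ν v x) t ≡ lookup x t xor (⟦ Φ ⟧ v ∧ lookup x s)
  forward-target (leaf a)  {s} {t} Λ v x z = addTo-target t s (v a) x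
  forward-target (const b) {s} {t} Λ v x z = addTo-target t s b x
  forward-target (add Φ Ψ) {s} {t} {ν} Λ v x z = begin
    lookup (forward Ψ s t _ v y) t
      ≡⟨ forward-target Ψ (add-right {m = muls Φ} Λ) v y (λ a → trans
           (forward-other Φ s t _ v x _ (Λ .ν≢t _) (λ b e → ↑ˡ≢↑ʳ b a (sym (Λ .inj e)))) (z _)) ⟩
    lookup y t xor (⟦ Ψ ⟧ v ∧ lookup y s)
      ≡⟨ cong₂ (λ c d → c xor (⟦ Ψ ⟧ v ∧ d)) (forward-target Φ (add-left {m = muls Φ} Λ) v x (z ∘ _))
           (forward-other Φ s t _ v x s (Λ .s≢t) (λ a e → Λ .ν≢s _ (sym e))) ⟩
    (lookup x t xor (⟦ Φ ⟧ v ∧ lookup x s)) xor (⟦ Ψ ⟧ v ∧ lookup x s)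
      ≡⟨ trans (xor-assoc (lookup x t) _ _) (cong (lookup x t xor_) (sym (∧-distribʳ-xor (lookup x s) (⟦ Φ ⟧ v) _))) ⟩
    lookup x t xor ((⟦ Φ ⟧ v xor ⟦ Ψ ⟧ v) ∧ lookup x s) ∎
    where
    open ≡-Reasoning
    y = forward Φ s t (ν ∘ (_↑ˡ muls Ψ)) v x
  forward-target (mul Φ Ψ) {s} {t} {ν} Λ v x z = begin
    lookup (forward Ψ (ν zero) t _ v y) t
      ≡⟨ forward-target Ψ (mul-right {m = muls Φ} Λ) v y (λ a → trans
           (forward-other Φ s (ν zero) _ v x _ (λ e → suc≢0 (Λ .inj e))
             (λ b e → ↑ˡ≢↑ʳ b a (sym (suc-injective (Λ .inj e))))) (z _)) ⟩
    lookup y t xor (⟦ Ψ ⟧ v ∧ lookup y (ν zero))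
      ≡⟨ cong₂ (λ c d → c xor (⟦ Ψ ⟧ v ∧ d))
           (forward-other Φ s (ν zero) _ v x t (λ e → Λ .ν≢t zero (sym e)) (λ a e → Λ .ν≢t _ (sym e)))
           (trans (forward-target Φ (mul-left {m = muls Φ} Λ) v x (z ∘ _)) (cong (_xor (⟦ Φ ⟧ v ∧ lookup x s)) (z zero))) ⟩
    lookup x t xor (⟦ Ψ ⟧ v ∧ (⟦ Φ ⟧ v ∧ lookup x s))
      ≡⟨ cong (lookup x t xor_) (trans (sym (∧-assoc (⟦ Ψ ⟧ v) _ _)) (cong (_∧ lookup x s) (∧-comm (⟦ Ψ ⟧ v) _))) ⟩
    lookup x t xor ((⟦ Φ ⟧ v ∧ ⟦ Ψ ⟧ v) ∧ lookup x s) ∎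
    where
    open ≡-Reasoning
    suc≢0 : ∀ {j} {a : Fin j} → suc a ≢ zero
    suc≢0 ()
    y = forward Φ s (ν zero) (ν ∘ suc ∘ (_↑ˡ muls Ψ)) v x

module _ {V S : Set} (s₀ : S) (n : ℕ) where

  -- Quantified over source and target because a polynomial calls its leaves with scratch registers
  -- in both roles. All registers may hold arbitrary contents.
  Adds : ((V → Bool) → Bool) → ℕ → Set
  Adds f ℓ = ∀ {i j : Fin n} → i ≢ j → Action s₀ (λ ρ → addTo i j (f ρ)) ℓ

  adds : ∀ {f ℓ} → Evaluator s₀ f ℓ → Adds f (2 * ℓ)
  adds E i≢j = act E (addPerm i≢j)

  adds-const : ∀ b → Adds (λ _ → b) 0
  adds-const b i≢j = freely (addPerm i≢j b)

  module _ {A : Set} (sem : A → (V → Bool) → Bool) (cost : A → ℕ) (leaves : ∀ a → Adds (sem a) (cost a)) where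

    forwardAction : ∀ Φ {s t : Fin n} {ν} → Layout s t ν →
      Action s₀ (λ ρ → forward Φ s t ν (λ a → sem a ρ)) (weight cost Φ)
    forwardAction (leaf a)  Λ = leaves a (Λ .s≢t ∘ sym)
    forwardAction (const b) Λ = adds-const b (Λ .s≢t ∘ sym)
    forwardAction (add Φ Ψ) Λ = forwardAction Φ (add-left {m = muls Φ} Λ) then forwardAction Ψ (add-right {m = muls Φ} Λ)
    forwardAction (mul Φ Ψ) Λ = forwardAction Φ (mul-left {m = muls Φ} Λ) then forwardAction Ψ (mul-right {m = muls Φ} Λ)

    backwardAction : ∀ Φ {s t : Fin n} {ν} → Layout s t ν →
      Action s₀ (λ ρ → backward Φ s t ν (λ a → sem a ρ)) (weight cost Φ)
    backwardAction (leaf a)  Λ = leaves a (Λ .s≢t ∘ sym)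
    backwardAction (const b) Λ = adds-const b (Λ .s≢t ∘ sym)
    backwardAction (add Φ Ψ) Λ = recast (λ _ _ → refl) (≤-reflexive (+-comm (weight cost Ψ) _))
      (backwardAction Ψ (add-right {m = muls Φ} Λ) then backwardAction Φ (add-left {m = muls Φ} Λ))
    backwardAction (mul Φ Ψ) Λ = recast (λ _ _ → refl) (≤-reflexive (+-comm (weight cost Ψ) _))
      (backwardAction Ψ (mul-right {m = muls Φ} Λ) then backwardAction Φ (mul-left {m = muls Φ} Λ))

module _ {k : ℕ} {i j : Fin (2 + k)} (i≢j : i ≢ j) where

  avoid : Fin k → Fin (2 + k)
  avoid a = punchIn i (punchIn (punchOut i≢j) a)

  avoid-injective : ∀ {a b} → avoid a ≡ avoid b → a ≡ b
  avoid-injective e = punchIn-injective _ _ _ (punchIn-injective i _ _ e)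

  avoid≢i : ∀ a → avoid a ≢ i
  avoid≢i a = punchInᵢ≢i i _

  avoid≢j : ∀ a → avoid a ≢ j
  avoid≢j a e = punchInᵢ≢i (punchOut i≢j) a (punchIn-injective i _ _ (trans e (sym (punchIn-punchOut i≢j))))

xor-cancels : ∀ x p q g → (((x xor p) xor q) xor (p xor g)) xor q ≡ x xor g
xor-cancels false false false false = refl
xor-cancels false false false true  = refl
xor-cancels false false true  false = refl
xor-cancels false false true  true  = refl
xor-cancels false true  false false = refl
xor-cancels false true  false true  = refl
xor-cancels false true  true  false = refl
xor-cancels false true  true  true  = refl
xor-cancels true  false false false = refl
xor-cancels true  false false true  = refl
xor-cancels true  false true  false = refl
xor-cancels true  false true  true  = refl
xor-cancels true  true  false false = refl
xor-cancels true  true  false true  = refl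
xor-cancels true  true  true  false = refl
xor-cancels true  true  true  true  = refl

module _ {A : Set} (Φ : Poly A) (v : A → Bool) {s t i j : Fin n} {ν : Fin (muls Φ) → Fin n} (Λ : Layout s t ν)
         (i≢j : i ≢ j) (i≢s : i ≢ s) (i≢t : i ≢ t) (j≢s : j ≢ s) (i∉ν : ∀ a → ν a ≢ i) where

  -- By linearity forward Φ changes register t by a fixed linear functional of the registers, garbage included.
  readout : Vec Bool n → Vec Bool n
  readout x = backward Φ s t ν v (addTo i t true (forward Φ s t ν v x))

  private
    L = forward Φ s t ν v

  forward-unit : ∀ x c → L (x ⊕ unit i c) ≡ L x ⊕ unit i c
  forward-unit x c = trans (forward-additive Φ s t ν v x (unit i c))
    (cong (L x ⊕_) (forward-idle Φ s t ν v (unit i c) (lookup-unit′ c (i≢s ∘ sym)) (λ a → lookup-unit′ c (i∉ν a))))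

  readout-value : ∀ x → readout x ≡ x ⊕ unit i (lookup (L x) t)
  readout-value x = trans (cong (backward Φ s t ν v) (sym (forward-unit x (lookup (L x) t))))
    (backward-forward Φ Λ v _)

  -- Reading before and after shifting register s by register j leaves only the (t , s) coefficient.
  isolate : ∀ x → addTo s j true (readout (addTo s j true (readout x))) ≡ addTo i j (⟦ Φ ⟧ v) x
  isolate x = trans eq (lookup-ext pointwise)
    where
    open ≡-Reasoning
    α = lookup (L x) t
    xⱼ = lookup x j
    γ = ⟦ Φ ⟧ v ∧ xⱼ
    x₁ = x ⊕ unit i α
    x₂ = x₁ ⊕ unit s xⱼ
    x₃ = x₂ ⊕ unit i (α xor γ)
    at-j : ∀ y k c → j ≢ k → lookup (y ⊕ unit k c) j ≡ lookup y j
    at-j y k c j≢k = trans (lookup-⊕ y _ j) (trans (cong (lookup y j xor_) (lookup-unit′ c j≢k)) (xor-identityʳ _))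
    x₁ⱼ : lookup x₁ j ≡ xⱼ
    x₁ⱼ = at-j x i α (i≢j ∘ sym)
    x₃ⱼ : lookup x₃ j ≡ xⱼ
    x₃ⱼ = trans (at-j x₂ i _ (i≢j ∘ sym)) (trans (at-j x₁ s xⱼ j≢s) x₁ⱼ)
    β : lookup (L x₂) t ≡ α xor γ
    β = begin
      lookup (L x₂) t ≡⟨ cong (λ y → lookup y t) (forward-additive Φ s t ν v x₁ (unit s xⱼ)) ⟩
      lookup (L x₁ ⊕ L (unit s xⱼ)) t ≡⟨ lookup-⊕ (L x₁) _ t ⟩
      lookup (L x₁) t xor lookup (L (unit s xⱼ)) t
        ≡⟨ cong₂ _xor_ (trans (cong (λ y → lookup y t) (forward-unit x α)) (trans (lookup-⊕ (L x) _ t)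
             (trans (cong (α xor_) (lookup-unit′ α (i≢t ∘ sym))) (xor-identityʳ α))))
             (trans (forward-target Φ Λ v (unit s xⱼ) (λ a → lookup-unit′ xⱼ (Λ .ν≢s a)))
               (cong₂ (λ c d → c xor (⟦ Φ ⟧ v ∧ d)) (lookup-unit′ xⱼ (Λ .s≢t ∘ sym)) (lookup-unit s xⱼ))) ⟩
      α xor γ ∎
    eq : addTo s j true (readout (addTo s j true (readout x))) ≡ x₃ ⊕ unit s xⱼ
    eq = begin
      addTo s j true (readout (addTo s j true (readout x)))
        ≡⟨ cong (addTo s j true ∘ readout ∘ addTo s j true) (readout-value x) ⟩
      addTo s j true (readout (x₁ ⊕ unit s (lookup x₁ j)))
        ≡⟨ cong (λ c → addTo s j true (readout (x₁ ⊕ unit s c))) x₁ⱼ ⟩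
      addTo s j true (readout x₂) ≡⟨ cong (addTo s j true) (readout-value x₂) ⟩
      addTo s j true (x₂ ⊕ unit i (lookup (L x₂) t)) ≡⟨ cong (λ c → addTo s j true (x₂ ⊕ unit i c)) β ⟩
      x₃ ⊕ unit s (lookup x₃ j) ≡⟨ cong (λ c → x₃ ⊕ unit s c) x₃ⱼ ⟩
      x₃ ⊕ unit s xⱼ ∎
    pointwise : ∀ k → lookup (x₃ ⊕ unit s xⱼ) k ≡ lookup (addTo i j (⟦ Φ ⟧ v) x) k
    pointwise k
      rewrite lookup-⊕ x₃ (unit s xⱼ) k | lookup-⊕ x₂ (unit i (α xor γ)) k | lookup-⊕ x₁ (unit s xⱼ) k
            | lookup-⊕ x (unit i α) k | unit-xor i α γ | lookup-⊕ (unit i α) (unit i γ) k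
            | lookup-⊕ x (unit i γ) k
      = xor-cancels (lookup x k) (lookup (unit i α) k) (lookup (unit s xⱼ) k) (lookup (unit i γ) k)

four-fold : ∀ w → (w + (0 + w)) + (0 + ((w + (0 + w)) + 0)) ≡ 4 * w
four-fold = solve-∀

-- Two readings of one forward and one backward pass each: four calls per leaf. Leaves and
-- polynomial use the same 4 + N registers (i, j, s, t and N scratch), so nesting costs no further
-- registers.
adds-poly : ∀ {V S A : Set} {s₀ : S} {N} (sem : A → (V → Bool) → Bool) (cost : A → ℕ) →
  (∀ a → Adds s₀ (4 + N) (sem a) (cost a)) → ∀ Φ → muls Φ ≤ N →
  Adds s₀ (4 + N) (λ ρ → ⟦ Φ ⟧ (λ a → sem a ρ)) (4 * weight cost Φ)
adds-poly {s₀ = s₀} {N} sem cost leaves Φ le {i} {j} i≢j =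
  recast (λ ρ → isolate Φ (λ a → sem a ρ) Λ i≢j (i≢ zero) (i≢ (suc zero)) (λ e → avoid≢j i≢j _ (sym e)) (λ a → avoid≢i i≢j _))
         (≤-reflexive (four-fold (weight cost Φ)))
         (reading then shifting then reading then shifting)
  where
  s t : Fin (4 + N)
  s = avoid i≢j zero
  t = avoid i≢j (suc zero)
  ν : Fin (muls Φ) → Fin (4 + N)
  ν a = avoid i≢j (suc (suc (inject≤ a le)))
  i≢ : ∀ a → i ≢ avoid i≢j a
  i≢ a e = avoid≢i i≢j a (sym e)
  distinct : ∀ {a b} → a ≢ b → avoid i≢j a ≢ avoid i≢j b
  distinct a≢b e = a≢b (avoid-injective i≢j e)
  Λ : Layout s t ν
  Λ = record
    { s≢t = distinct λ () ; ν≢s = λ a → distinct λ () ; ν≢t = λ a → distinct λ ()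
    ; inj = λ e → inject≤-injective le le _ _ (suc-injective (suc-injective (avoid-injective i≢j e))) }
  reading = forwardAction s₀ (4 + N) sem cost leaves Φ Λ then freely (addPerm (i≢ (suc zero)) true)
              then backwardAction s₀ (4 + N) sem cost leaves Φ Λ
  shifting = freely (addPerm {i = s} {j} (avoid≢j i≢j zero) true)

-- Splitting formulas

data Op : Set where
  plus times : Op

node : Op → Poly A → Poly A → Poly A
node plus  = add
node times = mul

apply : Op → Bool → Bool → Bool
apply plus  = _xor_
apply times = _∧_

apply-comm : ∀ o a b → apply o a b ≡ apply o b a
apply-comm plus  = xor-comm
apply-comm times = ∧-comm

node-value : ∀ o (F G : Poly A) v → ⟦ node o F G ⟧ v ≡ apply o (⟦ F ⟧ v) (⟦ G ⟧ v)
node-value plus  F G v = refl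
node-value times F G v = refl

node-weight : ∀ o (F G : Poly A) w → weight w (node o F G) ≡ weight w F + weight w G
node-weight plus  F G w = refl
node-weight times F G w = refl

node-muls : ∀ o (F G : Poly A) → muls (node o F G) ≤ suc (muls F + muls G)
node-muls plus  F G = n≤1+n _
node-muls times F G = ≤-refl

leafCount : Poly A → ℕ
leafCount = weight (λ _ → 1)

-- The path from the root to a hole, with the operation and the sibling subformula at every node.
-- Both operations commute, so sides are not recorded.
Context : Set → Set
Context A = List (Op × Poly A)

fill : Context A → (A → Bool) → Bool → Bool
fill []            v x = x
fill ((o , F) ∷ C) v x = apply o (⟦ F ⟧ v) (fill C v x)

contextWeight : (A → ℕ) → Context A → ℕ
contextWeight w []            = 0
contextWeight w ((o , F) ∷ C) = weight w F + contextWeight w C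

slope offset : Context A → Poly A
slope []                = const true
slope ((plus  , F) ∷ C) = slope C
slope ((times , F) ∷ C) = mul F (slope C)
offset []            = const false
offset ((o , F) ∷ C) = node o F (offset C)

fill-affine : ∀ (C : Context A) v x → ⟦ offset C ⟧ v xor (⟦ slope C ⟧ v ∧ x) ≡ fill C v x
fill-affine [] v x = refl
fill-affine ((plus , F) ∷ C) v x = trans (xor-assoc (⟦ F ⟧ v) _ _) (cong (⟦ F ⟧ v xor_) (fill-affine C v x))
fill-affine ((times , F) ∷ C) v x with ⟦ F ⟧ v
... | false = refl
... | true  = fill-affine C v x

offset-weight : ∀ (w : A → ℕ) C → weight w (offset C) ≡ contextWeight w C
offset-weight w []            = refl
offset-weight w ((o , F) ∷ C) = trans (node-weight o F (offset C) w) (cong (weight w F +_) (offset-weight w C))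

slope-weight : ∀ (w : A → ℕ) C → weight w (slope C) ≤ contextWeight w C
slope-weight w []                = z≤n
slope-weight w ((plus  , F) ∷ C) = ≤-trans (slope-weight w C) (m≤n+m _ _)
slope-weight w ((times , F) ∷ C) = +-monoʳ-≤ (weight w F) (slope-weight w C)

fill-++ : ∀ (C D : Context A) v x → fill (C ++ D) v x ≡ fill C v (fill D v x)
fill-++ []            D v x = refl
fill-++ ((o , F) ∷ C) D v x = cong (apply o (⟦ F ⟧ v)) (fill-++ C D v x)

contextWeight-++ : ∀ (w : A → ℕ) C D → contextWeight w (C ++ D) ≡ contextWeight w C + contextWeight w D
contextWeight-++ w []            D = refl
contextWeight-++ w ((o , F) ∷ C) D = trans (cong (weight w F +_) (contextWeight-++ w C D)) (sym (+-assoc (weight w F) _ _))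

-- `heavy` is there to bound the context: if F has at most 2 n leaves, fewer than n of them remain
-- for `ctx`.
record Core (n : ℕ) (F : Poly A) : Set where
  field
    ctx        : Context A
    op         : Op
    left right : Poly A
    value      : ∀ v → fill ctx v (apply op (⟦ left ⟧ v) (⟦ right ⟧ v)) ≡ ⟦ F ⟧ v
    total      : ∀ w → contextWeight w ctx + (weight w left + weight w right) ≡ weight w F
    left≤      : leafCount left ≤ n
    right≤     : leafCount right ≤ n
    heavy      : n < leafCount left + leafCount right
open Core

extend : ∀ {n o} {F G H : Poly A} → (∀ v → apply o (⟦ G ⟧ v) (⟦ F ⟧ v) ≡ ⟦ H ⟧ v) →
         (∀ w → weight w G + weight w F ≡ weight w H) → Core n F → Core n H
extend {o = o} {G = G} val tot c = record
  { ctx = (o , G) ∷ c .ctx ; op = c .op ; left = c .left ; right = c .right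
  ; value = λ v → trans (cong (apply o (⟦ G ⟧ v)) (c .value v)) (val v)
  ; total = λ w → trans (+-assoc (weight w G) _ _) (trans (cong (weight w G +_) (c .total w)) (tot w))
  ; left≤ = c .left≤ ; right≤ = c .right≤ ; heavy = c .heavy }

-- Descend towards a child with more than n leaves as long as there is one.
core : ∀ {n} → 1 ≤ n → (F : Poly A) → leafCount F ≤ n ⊎ Core n F
core-node : ∀ {n} o (F G : Poly A) → leafCount F ≤ n ⊎ Core n F → leafCount G ≤ n ⊎ Core n G →
            leafCount (node o F G) ≤ n ⊎ Core n (node o F G)

core 1≤n (leaf a)  = inj₁ 1≤n
core 1≤n (const b) = inj₁ z≤n
core 1≤n (add F G) = core-node plus F G (core 1≤n F) (core 1≤n G)
core 1≤n (mul F G) = core-node times F G (core 1≤n F) (core 1≤n G)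

core-node o F G (inj₂ c) _ = inj₂ (extend {o = o} {F} {G}
  (λ v → trans (apply-comm o _ _) (sym (node-value o F G v)))
  (λ w → trans (+-comm (weight w G) _) (sym (node-weight o F G w))) c)
core-node o F G (inj₁ _) (inj₂ c) = inj₂ (extend {o = o} {G} {F}
  (λ v → sym (node-value o F G v)) (λ w → sym (node-weight o F G w)) c)
core-node {n = n} o F G (inj₁ f) (inj₁ g) with leafCount F + leafCount G ≤? n
... | yes le = inj₁ (subst (_≤ n) (sym (node-weight o F G _)) le)
... | no ≰ = inj₂ (record
  { ctx = [] ; op = o ; left = F ; right = G
  ; value = λ v → sym (node-value o F G v) ; total = λ w → sym (node-weight o F G w)
  ; left≤ = f ; right≤ = g ; heavy = ≰⇒> ≰ })

contextSize : Context A → ℕ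
contextSize = contextWeight (λ _ → 1)

-- The cut is at the first sibling that carries the total above n. That sibling can be large itself,
-- but when C has size at most 2 n, `heavy` leaves less than n for `inner`.
record Cut (n : ℕ) (C : Context A) : Set where
  constructor mkCut
  field
    outer : Context A
    op    : Op
    mid   : Poly A
    inner : Context A
    split : C ≡ outer ++ (op , mid) ∷ inner
    outer≤ : contextSize outer ≤ n
    heavy  : n < contextSize outer + leafCount mid

cut : ∀ n (C : Context A) → contextSize C ≤ n ⊎ Cut n C
cut n [] = inj₁ z≤n
cut n ((o , F) ∷ C) with leafCount F ≤? n
... | no ≰ = inj₂ (mkCut [] o F C refl z≤n (≰⇒> ≰))
... | yes le with cut (n ∸ leafCount F) C
...   | inj₁ small = inj₁ (subst (leafCount F + contextSize C ≤_) (m+[n∸m]≡n le) (+-monoʳ-≤ (leafCount F) small))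
...   | inj₂ (mkCut C₁ p G C₂ eq small big) = inj₂ (mkCut ((o , F) ∷ C₁) p G C₂ (cong ((o , F) ∷_) eq)
        (subst (leafCount F + contextSize C₁ ≤_) (m+[n∸m]≡n le) (+-monoʳ-≤ (leafCount F) small))
        (subst₂ _<_ (m+[n∸m]≡n le) (sym (+-assoc (leafCount F) _ _)) (+-monoʳ-< (leafCount F) big)))

Piece : Set → ℕ → Set
Piece A M = Σ (Poly A) λ F → leafCount F ≤ M

record Skeleton {A : Set} (M : ℕ) (val : (A → Bool) → Bool) (wt : (A → ℕ) → ℕ) (B : ℕ) : Set where
  field
    poly    : Poly (Piece A M)
    value   : ∀ v → ⟦ poly ⟧ (λ p → ⟦ proj₁ p ⟧ v) ≡ val v
    weight≤ : ∀ w → weight (weight w ∘ proj₁) poly ≤ wt w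
    muls≤   : muls poly ≤ B
open Skeleton

module _ {A : Set} {M : ℕ} where

  relax : ∀ {val val′ wt wt′ B B′} → (∀ v → val v ≡ val′ v) → (∀ w → wt w ≤ wt′ w) → B ≤ B′ →
          Skeleton {A} M val wt B → Skeleton M val′ wt′ B′
  relax e lw lb X = record { poly = X .poly ; value = λ v → trans (X .value v) (e v)
                           ; weight≤ = λ w → ≤-trans (X .weight≤ w) (lw w) ; muls≤ = ≤-trans (X .muls≤) lb }

  joined : ∀ {val val′ wt wt′ B B′} o → Skeleton {A} M val wt B → Skeleton M val′ wt′ B′ →
           Skeleton M (λ v → apply o (val v) (val′ v)) (λ w → wt w + wt′ w) (suc (B + B′))
  joined o X Y = record
    { poly = node o (X .poly) (Y .poly)
    ; value = λ v → trans (node-value o (X .poly) (Y .poly) _) (cong₂ (apply o) (X .value v) (Y .value v))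
    ; weight≤ = λ w → subst (_≤ _) (sym (node-weight o (X .poly) (Y .poly) _)) (+-mono-≤ (X .weight≤ w) (Y .weight≤ w))
    ; muls≤ = ≤-trans (node-muls o (X .poly) (Y .poly)) (s≤s (+-mono-≤ (X .muls≤) (Y .muls≤))) }

  piece : ∀ (F : Poly A) → leafCount F ≤ M → Skeleton M ⟦ F ⟧ (λ w → weight w F) 0
  piece F le = record { poly = leaf (F , le) ; value = λ _ → refl ; weight≤ = λ _ → ≤-refl ; muls≤ = z≤n }

doubled : ℕ → ℕ → ℕ
doubled M zero    = M
doubled M (suc r) = doubled M r + doubled M r

-- These depend on r alone, not on M: the number of registers stays constant when the splitting is
-- iterated over growing formulas.
valueMuls contextMuls : ℕ → ℕ
valueMuls zero      = 0
valueMuls (suc r)   = contextMuls r + suc (valueMuls r + valueMuls r)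
contextMuls zero    = 1
contextMuls (suc r) = contextMuls r + suc (valueMuls (suc r) + contextMuls r)

M≤doubled : ∀ M r → M ≤ doubled M r
M≤doubled M zero    = ≤-refl
M≤doubled M (suc r) = ≤-trans (M≤doubled M r) (m≤m+n _ _)

valueMuls-step : ∀ r → valueMuls r ≤ valueMuls (suc r)
valueMuls-step r = ≤-trans (m≤m+n _ _) (≤-trans (n≤1+n _) (m≤n+m _ _))

-- A value costs its context plus two halves; a context costs two shorter contexts and the value between
-- them. Only contexts that are not split further are duplicated, into offset and slope, hence the factor 2.
splitValue : ∀ {M} → 1 ≤ M → ∀ r (F : Poly A) → leafCount F ≤ doubled M r →
             Skeleton M ⟦ F ⟧ (λ w → 2 * weight w F) (valueMuls r)
splitContext : ∀ {M} → 1 ≤ M → ∀ r (C : Context A) → contextSize C ≤ doubled M r →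
               ∀ {val wt B} → Skeleton M val wt B →
               Skeleton M (λ v → fill C v (val v)) (λ w → 2 * contextWeight w C + wt w) (contextMuls r + B)

splitValue 1≤M zero F le = relax (λ _ → refl) (λ w → m≤n*m (weight w F) 2) ≤-refl (piece F le)
splitValue {M = M} 1≤M (suc r) F le with core (≤-trans 1≤M (M≤doubled M r)) F
... | inj₁ small = relax (λ _ → refl) (λ _ → ≤-refl) (valueMuls-step r) (splitValue 1≤M r F small)
... | inj₂ c = relax (c .value) (λ w → ≤-reflexive (trans (arith (contextWeight w (c .ctx)) (weight w (c .left)) (weight w (c .right))) (cong (2 *_) (c .total w)))) ≤-refl
    (splitContext 1≤M r (c .ctx) ctx≤
      (joined (c .op) (splitValue 1≤M r (c .left) (c .left≤)) (splitValue 1≤M r (c .right) (c .right≤))))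
  where
  arith : ∀ a b c → 2 * a + (2 * b + 2 * c) ≡ 2 * (a + (b + c))
  arith = solve-∀
  ctx≤ : contextSize (c .ctx) ≤ doubled M r
  ctx≤ = +-cancelʳ-≤ (doubled M r) _ _ (≤-trans (+-monoʳ-≤ (contextSize (c .ctx)) (<⇒≤ (c .heavy)))
           (≤-trans (≤-reflexive (c .total _)) le))

splitContext 1≤M zero C le {val} {wt} X = relax (λ v → fill-affine C v (val v))
  (λ w → ≤-trans (+-mono-≤ (≤-reflexive (offset-weight w C)) (+-monoˡ-≤ (wt w) (slope-weight w C)))
                 (≤-reflexive (arith (contextWeight w C) (wt w)))) ≤-refl
  (record { poly = add (leaf (offset C , ≤-trans (≤-reflexive (offset-weight _ C)) le))
                       (mul (leaf (slope C , ≤-trans (slope-weight _ C) le)) (X .poly))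
          ; value = λ v → cong (λ b → ⟦ offset C ⟧ v xor (⟦ slope C ⟧ v ∧ b)) (X .value v)
          ; weight≤ = λ w → +-monoʳ-≤ (weight w (offset C)) (+-monoʳ-≤ (weight w (slope C)) (X .weight≤ w))
          ; muls≤ = s≤s (X .muls≤) })
  where
  arith : ∀ a b → a + (a + b) ≡ 2 * a + b
  arith = solve-∀
-- The sibling at the cut may have as many leaves as C, hence `splitValue` at level `suc r`; that
-- one calls only level r, so the recursion is well-founded.
splitContext {M = M} 1≤M (suc r) C le {val} {wt} {B} X with cut (doubled M r) C | splitValue 1≤M (suc r)
... | inj₁ small | _ = relax (λ _ → refl) (λ _ → ≤-refl) (+-monoˡ-≤ B (m≤m+n _ _)) (splitContext 1≤M r C small X)
... | inj₂ (mkCut C₁ o F C₂ refl C₁≤ heavy) | splitMid =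
  relax (λ v → sym (fill-++ C₁ ((o , F) ∷ C₂) v (val v)))
        (λ w → ≤-reflexive (trans (arith (contextWeight w C₁) (weight w F) (contextWeight w C₂) (wt w))
                                  (cong (λ t → 2 * t + wt w) (sym (contextWeight-++ w C₁ ((o , F) ∷ C₂))))))
        (≤-reflexive (assoc (contextMuls r) (valueMuls (suc r)) (contextMuls r) B))
    (splitContext 1≤M r C₁ C₁≤ (joined o (splitMid F F≤) (splitContext 1≤M r C₂ C₂≤ X)))
  where
  arith : ∀ a b c d → 2 * a + (2 * b + (2 * c + d)) ≡ 2 * (a + (b + c)) + d
  arith = solve-∀
  assoc : ∀ a b c d → a + suc (b + (c + d)) ≡ a + suc (b + c) + d
  assoc = solve-∀
  size-eq : contextSize (C₁ ++ (o , F) ∷ C₂) ≡ contextSize C₁ + (leafCount F + contextSize C₂)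
  size-eq = contextWeight-++ _ C₁ ((o , F) ∷ C₂)
  F≤ : leafCount F ≤ doubled M (suc r)
  F≤ = ≤-trans (≤-trans (m≤m+n _ _) (m≤n+m _ (contextSize C₁))) (≤-trans (≤-reflexive (sym size-eq)) le)
  C₂≤ : contextSize C₂ ≤ doubled M r
  C₂≤ = +-cancelˡ-≤ (doubled M r) _ _ (≤-trans (+-monoˡ-≤ (contextSize C₂) (<⇒≤ heavy))
          (≤-trans (≤-reflexive (trans (+-assoc (contextSize C₁) _ _) (sym size-eq))) le))

-- Iterated splitting on a constant number of registers

constant : ∀ (F : Poly A) → leafCount F ≡ 0 → Σ Bool λ b → ∀ v → ⟦ F ⟧ v ≡ b
constant (const b) _ = b , λ _ → refl
constant (add F G) eq with constant F (m+n≡0⇒m≡0 _ eq) | constant G (m+n≡0⇒n≡0 (leafCount F) eq)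
... | b , f | c , g = b xor c , λ v → cong₂ _xor_ (f v) (g v)
constant (mul F G) eq with constant F (m+n≡0⇒m≡0 _ eq) | constant G (m+n≡0⇒n≡0 (leafCount F) eq)
... | b , f | c , g = b ∧ c , λ v → cong₂ _∧_ (f v) (g v)

sum≤1 : ∀ m n → m + n ≤ 1 → (m ≡ 0 × n ≤ 1) ⊎ (n ≡ 0 × m ≤ 1)
sum≤1 zero    n le = inj₁ (refl , le)
sum≤1 (suc m) n (s≤s le) = inj₂ (n≤0⇒n≡0 (≤-trans (m≤n+m n m) le) , s≤s (≤-trans (m≤m+n m n) le))

threshold : ℕ → ℕ → ℕ
threshold r zero    = 1
threshold r (suc K) = doubled (threshold r K) r

1≤threshold : ∀ r K → 1 ≤ threshold r K
1≤threshold r zero    = ≤-refl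
1≤threshold r (suc K) = ≤-trans (1≤threshold r K) (M≤doubled _ r)

weight-scale : ∀ c (w : A → ℕ) F → weight (λ a → c * w a) F ≡ c * weight w F
weight-scale c w (leaf a)  = refl
weight-scale c w (const b) = sym (*-zeroʳ c)
weight-scale c w (add F G) = trans (cong₂ _+_ (weight-scale c w F) (weight-scale c w G)) (sym (*-distribˡ-+ c _ _))
weight-scale c w (mul F G) = trans (cong₂ _+_ (weight-scale c w F) (weight-scale c w G)) (sym (*-distribˡ-+ c _ _))

addTo-merge : ∀ {n} {i j : Fin n} → i ≢ j → ∀ b c x → addTo i j c (addTo i j b x) ≡ addTo i j (b xor c) x
addTo-merge {i = i} {j} i≢j b c x = begin
  (x ⊕ unit i (b ∧ xⱼ)) ⊕ unit i (c ∧ lookup (addTo i j b x) j)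
    ≡⟨ cong (λ d → (x ⊕ unit i (b ∧ xⱼ)) ⊕ unit i (c ∧ d)) (addTo-other {i = i} j b x (i≢j ∘ sym)) ⟩
  (x ⊕ unit i (b ∧ xⱼ)) ⊕ unit i (c ∧ xⱼ) ≡⟨ zipWith-assoc xor-assoc x _ _ ⟩
  x ⊕ (unit i (b ∧ xⱼ) ⊕ unit i (c ∧ xⱼ)) ≡⟨ cong (x ⊕_) (sym (unit-xor i _ _)) ⟩
  x ⊕ unit i ((b ∧ xⱼ) xor (c ∧ xⱼ)) ≡⟨ cong (λ d → x ⊕ unit i d) (sym (∧-distribʳ-xor xⱼ b c)) ⟩
  x ⊕ unit i ((b xor c) ∧ xⱼ) ∎
  where
  open ≡-Reasoning
  xⱼ = lookup x j

module _ {V S : Set} {s₀ : S} {n : ℕ} where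

  adds-xor : ∀ {f g : (V → Bool) → Bool} {ℓ ℓ′} → Adds s₀ n f ℓ → Adds s₀ n g ℓ′ →
             Adds s₀ n (λ ρ → f ρ xor g ρ) (ℓ + ℓ′)
  adds-xor f g i≢j = recast (λ ρ x → addTo-merge i≢j _ _ x) ≤-refl (f i≢j then g i≢j)

  adds-∧ : ∀ {f : (V → Bool) → Bool} {ℓ} b → Adds s₀ n f ℓ → Adds s₀ n (λ ρ → b ∧ f ρ) ℓ
  adds-∧ true  f = f
  adds-∧ false f i≢j = recast (λ _ _ → refl) z≤n (adds-const s₀ n false i≢j)

module _ {V S A : Set} {s₀ : S} (r : ℕ) (sem : A → (V → Bool) → Bool) (cost : A → ℕ)
         (leaves : ∀ a → Adds s₀ (4 + valueMuls r) (sem a) (cost a)) where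

  private
    semantics : Poly A → (V → Bool) → Bool
    semantics F ρ = ⟦ F ⟧ (λ a → sem a ρ)

  -- With at most one leaf, every product has a constant factor, so direct calls suffice and no
  -- scratch register is needed.
  adds-small : ∀ F → leafCount F ≤ 1 → Adds s₀ (4 + valueMuls r) (semantics F) (weight cost F)
  adds-small (leaf a)  le = leaves a
  adds-small (const b) le = adds-const _ _ b
  adds-small (add F G) le = adds-xor (adds-small F (≤-trans (m≤m+n _ _) le)) (adds-small G (≤-trans (m≤n+m _ _) le))
  adds-small (mul F G) le i≢j with sum≤1 (leafCount F) (leafCount G) le
  ... | inj₁ (F≡0 , G≤1) = let (b , eq) = constant F F≡0 in
    recast (λ ρ x → cong (λ c → addTo _ _ (c ∧ semantics G ρ) x) (sym (eq _))) (m≤n+m _ _)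
      (adds-∧ b (adds-small G G≤1) i≢j)
  ... | inj₂ (G≡0 , F≤1) = let (b , eq) = constant G G≡0 in
    recast (λ ρ x → cong (λ c → addTo _ _ c x) (trans (∧-comm b _) (cong (semantics F ρ ∧_) (sym (eq _))))) (m≤m+n _ _)
      (adds-∧ b (adds-small F F≤1) i≢j)

  -- Each level multiplies the admissible number of leaves by 2^r and the cost by 8 = 4 · 2: four
  -- calls per piece, and pieces of at most twice the total weight.
  adds-bounded : ∀ K F → leafCount F ≤ threshold r K → Adds s₀ (4 + valueMuls r) (semantics F) (8 ^ K * weight cost F)
  adds-bounded zero F le = λ i≢j → recast (λ _ _ → refl) (≤-reflexive (sym (*-identityˡ (weight cost F)))) (adds-small F le i≢j)
  adds-bounded (suc K) F le i≢j = recast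
      (λ ρ x → cong (λ b → addTo _ _ b x) (X .value (λ a → sem a ρ)))
      bound
      (adds-poly (semantics ∘ proj₁) (λ p → 8 ^ K * weight cost (proj₁ p))
        (λ (G , G≤) → adds-bounded K G G≤) (X .poly) (X .muls≤) i≢j)
    where
    X = splitValue (1≤threshold r K) r F le
    arith : ∀ a b → 4 * (a * (2 * b)) ≡ 8 * a * b
    arith = solve-∀
    bound : 4 * weight (λ p → 8 ^ K * weight cost (proj₁ p)) (X .poly) ≤ 8 ^ suc K * weight cost F
    bound = begin
      4 * weight (λ p → 8 ^ K * weight cost (proj₁ p)) (X .poly)
        ≡⟨ cong (4 *_) (weight-scale (8 ^ K) _ (X .poly)) ⟩
      4 * (8 ^ K * weight (weight cost ∘ proj₁) (X .poly))
        ≤⟨ *-monoʳ-≤ 4 (*-monoʳ-≤ (8 ^ K) (X .weight≤ cost)) ⟩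
      4 * (8 ^ K * (2 * weight cost F))
        ≡⟨ arith (8 ^ K) (weight cost F) ⟩
      8 ^ suc K * weight cost F ∎
      where open ≤-Reasoning

-- Simulating formulas with majority gates

module _ {P x : ℕ} (p≤P : suc x ≤ P) where

  -- Positions from p on stay fixed, so a single counter with P positions serves every modulus p ≤
  -- P.
  turn : ℕ → Fin P → Fin P
  turn v c with toℕ c <? suc x
  ... | yes _ = fromℕ< (<-≤-trans (m%n<n (toℕ c + v) (suc x)) p≤P)
  ... | no _  = c

  toℕ-turn : ∀ v c → toℕ c < suc x → toℕ (turn v c) ≡ (toℕ c + v) % suc x
  toℕ-turn v c c<p with toℕ c <? suc x
  ... | yes _ = toℕ-fromℕ< _
  ... | no ≮  = ⊥-elim (≮ c<p)

  turn-fixed : ∀ v c → ¬ toℕ c < suc x → turn v c ≡ c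
  turn-fixed v c ≮ with toℕ c <? suc x
  ... | yes < = ⊥-elim (≮ <)
  ... | no _  = refl

  turn-turn : ∀ v w c → turn w (turn v c) ≡ turn (v + w) c
  turn-turn v w c = toℕ-injective (cases (toℕ c <? suc x))
    where
    cases : _ → toℕ (turn w (turn v c)) ≡ toℕ (turn (v + w) c)
    cases (no ≮) = cong toℕ (trans (cong (turn w) (turn-fixed v c ≮)) (trans (turn-fixed w c ≮) (sym (turn-fixed (v + w) c ≮))))
    cases (yes c<p) = begin
      toℕ (turn w (turn v c)) ≡⟨ toℕ-turn w (turn v c) (subst (_< suc x) (sym (toℕ-turn v c c<p)) (m%n<n (toℕ c + v) (suc x))) ⟩
      (toℕ (turn v c) + w) % p ≡⟨ cong (λ t → (t + w) % p) (toℕ-turn v c c<p) ⟩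
      ((toℕ c + v) % p + w) % p ≡⟨ %-distribˡ-+ ((toℕ c + v) % p) w p ⟩
      ((toℕ c + v) % p % p + w % p) % p ≡⟨ cong (λ t → (t + w % p) % p) (m%n%n≡m%n (toℕ c + v) p) ⟩
      ((toℕ c + v) % p + w % p) % p ≡⟨ sym (%-distribˡ-+ (toℕ c + v) w p) ⟩
      (toℕ c + v + w) % p ≡⟨ cong (_% p) (+-assoc (toℕ c) v w) ⟩
      (toℕ c + (v + w)) % p ≡⟨ sym (toℕ-turn (v + w) c c<p) ⟩
      toℕ (turn (v + w) c) ∎
      where
      open ≡-Reasoning
      p = suc x

  turn-full : ∀ v c → turn (v * suc x) c ≡ c
  turn-full v c = toℕ-injective (cases (toℕ c <? suc x))
    where
    cases : _ → toℕ (turn (v * suc x) c) ≡ toℕ c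
    cases (no ≮) = cong toℕ (turn-fixed (v * suc x) c ≮)
    cases (yes c<p) = trans (toℕ-turn (v * suc x) c c<p)
      (trans ([m+kn]%n≡m%n (toℕ c) v (suc x)) (m<n⇒m%n≡m c<p))

  -- Since x = p - 1 acts as - 1 modulo p, turning by v x undoes turning by v.
  rotation : ℕ → Fin P ↔ Fin P
  rotation v = mk↔ₛ′ (turn v) (turn (v * x))
    (λ c → trans (turn-turn (v * x) v c) (trans (cong (λ t → turn t c) (trans (+-comm (v * x) v) (sym (*-suc v x)))) (turn-full v c)))
    (λ c → trans (turn-turn v (v * x) c) (trans (cong (λ t → turn t c) (sym (*-suc v x))) (turn-full v c)))

sumFin-≤ : ∀ k {f g : Fin k → ℕ} → (∀ i → f i ≤ g i) → sumFin k f ≤ sumFin k g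
sumFin-≤ zero    le = z≤n
sumFin-≤ (suc k) le = +-mono-≤ (le zero) (sumFin-≤ k (le ∘ suc))

sumFin-* : ∀ k c (f : Fin k → ℕ) → sumFin k (λ i → c * f i) ≡ c * sumFin k f
sumFin-* zero    c f = sym (*-zeroʳ c)
sumFin-* (suc k) c f = trans (cong (c * f zero +_) (sumFin-* k c (f ∘ suc))) (sym (*-distribˡ-+ c _ _))

≤sumFin : ∀ k (f : Fin k → ℕ) i → f i ≤ sumFin k f
≤sumFin (suc k) f zero    = m≤m+n _ _
≤sumFin (suc k) f (suc i) = ≤-trans (≤sumFin k (f ∘ suc) i) (m≤n+m _ _)

≤maxFin : ∀ k (f : Fin k → ℕ) i → f i ≤ maxFin k f
≤maxFin (suc k) f zero    = m≤m⊔n _ _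
≤maxFin (suc k) f (suc i) = ≤-trans (≤maxFin k (f ∘ suc) i) (m≤n⊔m _ _)

sumFin≥ : ∀ k (f : Fin k → ℕ) → (∀ i → 1 ≤ f i) → k ≤ sumFin k f
sumFin≥ zero    f 1≤ = z≤n
sumFin≥ (suc k) f 1≤ = +-mono-≤ (1≤ zero) (sumFin≥ k (f ∘ suc) (1≤ ∘ suc))

countTrue≤ : ∀ k f → countTrue k f ≤ k
countTrue≤ zero    f = z≤n
countTrue≤ (suc k) f with f zero
... | true  = s≤s (countTrue≤ k (f ∘ suc))
... | false = m≤n⇒m≤1+n (countTrue≤ k (f ∘ suc))

-- Programs that count and rotate

module _ {V S : Set} {s₀ : S} {P : ℕ} where

  counting : ∀ {x} (p≤ : suc x ≤ P) k {f : Fin k → (V → Bool) → Bool} {ℓ : Fin k → ℕ} →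
    (∀ i → Evaluator s₀ (f i) (ℓ i)) →
    Action s₀ (λ ρ → turn p≤ (countTrue k (λ i → f i ρ))) (2 * sumFin k ℓ)
  counting p≤ zero    E = recast (λ _ c → sym (turn-full p≤ 0 c)) z≤n (freely ↔-refl)
  counting p≤ (suc k) {ℓ = ℓ} E = recast (λ _ c → turn-turn p≤ _ _ c) (≤-reflexive (sym (*-distribˡ-+ 2 (ℓ zero) _)))
    (act (E zero) (λ b → rotation p≤ (if b then 1 else 0)) then counting p≤ k (E ∘ suc))

module _ {V S : Set} {s₀ : S} {P h k : ℕ} {f : Fin k → (V → Bool) → Bool} {ℓ : Fin k → ℕ}
         (E : ∀ i → Evaluator s₀ (f i) (ℓ i)) where

  private
    count : (V → Bool) → ℕ
    count ρ = countTrue k (λ i → f i ρ)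

    start : Fin (suc P) × S
    start = zero , s₀

  counter : ∀ {x} → suc x ≤ suc P → Evaluator start (λ ρ → count ρ % suc x) (2 * sumFin k ℓ)
  counter p≤ = reinterpret id (λ ρ → toℕ-turn p≤ (count ρ) zero (s≤s z≤n)) ≤-refl (evaluate zero toℕ (counting p≤ k E))

  -- Unfolding `angles` gives 2^m terms. Each computes and uncomputes one count, and counting
  -- computes and uncomputes every child, hence four runs of a child per term. The multiplier c
  -- collects the factors h met on the way.
  turningAngles : ∀ m x c → suc x + m ≤ suc P →
    Action start (λ ρ → turn {suc h} ≤-refl (c * angles h k (count ρ) m x)) (2 ^ m * (4 * sumFin k ℓ))
  turningAngles zero x c le = recast (λ _ _ → refl) (≤-reflexive (quadruple (sumFin k ℓ)))
    (act (counter (≤-trans (m≤m+n (suc x) 0) le)) (λ a → rotation ≤-refl (c * angle (suc h) k x a)))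
    where
    quadruple : ∀ n → 2 * (2 * n) ≡ 1 * (4 * n)
    quadruple = solve-∀
  turningAngles (suc m) x c le = recast
    (λ ρ a → trans (turn-turn ≤-refl _ _ a) (cong (λ v → turn ≤-refl v a) (distribute c h _ _)))
    (≤-reflexive (twice (2 ^ m) _))
    (turningAngles m x c (≤-trans (+-monoʳ-≤ (suc x) (n≤1+n m)) le) then
     turningAngles m (suc x) (c * h) (≤-trans (≤-reflexive (sym (+-suc (suc x) m))) le))
    where
    distribute : ∀ c h a b → c * a + c * h * b ≡ c * (a + h * b)
    distribute = solve-∀
    twice : ∀ a b → a * b + a * b ≡ 2 * a * b
    twice = solve-∀

  centredAngle : ∀ m x → suc x + m ≤ suc P →
    Evaluator (zero , start) (λ ρ → centre (suc h) (angles h k (count ρ) m x % suc h)) (2 ^ m * (4 * sumFin k ℓ))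
  centredAngle m x le = reinterpret (centre (suc h) ∘ toℕ)
    (λ ρ → cong (centre (suc h)) (trans (toℕ-turn ≤-refl (1 * angles h k (count ρ) m x) zero (s≤s z≤n)) (cong (_% suc h) (*-identityˡ (angles h k (count ρ) m x))))) ≤-refl
    (evaluate zero id (turningAngles m x 1 le))

-- Gates as polynomials

conj : ∀ k → (Fin k → Bool) → Bool
conj zero    f = true
conj (suc k) f = f zero ∧ conj k (f ∘ suc)

disj : ∀ k → (Fin k → Bool) → Bool
disj k f = not (conj k (not ∘ f))

parities : ∀ k → (Fin k → Bool) → Bool
parities zero    f = false
parities (suc k) f = f zero xor parities k (f ∘ suc)

≤ᵇ-suc : ∀ m n → (suc m ≤ᵇ suc n) ≡ (m ≤ᵇ n)
≤ᵇ-suc zero    n = refl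
≤ᵇ-suc (suc m) n = refl

<⇒≰ᵇ : ∀ {m n} → n < m → (m ≤ᵇ n) ≡ false
<⇒≰ᵇ {suc zero}    {zero}  _ = refl
<⇒≰ᵇ {suc (suc m)} {zero}  _ = refl
<⇒≰ᵇ {suc m} {suc n} (s≤s lt) = trans (≤ᵇ-suc m n) (<⇒≰ᵇ lt)

and-count : ∀ k f → gateEval AND k f ≡ conj k f
and-count zero    f = refl
and-count (suc k) f with f zero
... | true  = trans (≤ᵇ-suc k _) (and-count k (f ∘ suc))
... | false = <⇒≰ᵇ (s≤s (countTrue≤ k (f ∘ suc)))

or-count : ∀ k f → gateEval OR k f ≡ disj k f
or-count zero    f = refl
or-count (suc k) f with f zero
... | true  = refl
... | false = or-count k (f ∘ suc)

xor-count : ∀ k f → gateEval XOR k f ≡ parities k f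
xor-count zero    f = refl
xor-count (suc k) f with f zero
... | true  = cong not (xor-count k (f ∘ suc))
... | false = xor-count k (f ∘ suc)

module _ {A : Set} where

  product sum : ∀ k → (Fin k → Poly A) → Poly A
  product zero    F = const true
  product (suc k) F = mul (F zero) (product k (F ∘ suc))
  sum zero    F = const false
  sum (suc k) F = add (F zero) (sum k (F ∘ suc))

  negate : Poly A → Poly A
  negate F = add (const true) F

  product-value : ∀ k F v {f} → (∀ i → ⟦ F i ⟧ v ≡ f i) → ⟦ product k F ⟧ v ≡ conj k f
  product-value zero    F v eq = refl
  product-value (suc k) F v eq = cong₂ _∧_ (eq zero) (product-value k (F ∘ suc) v (eq ∘ suc))

  sum-value : ∀ k F v {f} → (∀ i → ⟦ F i ⟧ v ≡ f i) → ⟦ sum k F ⟧ v ≡ parities k f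
  sum-value zero    F v eq = refl
  sum-value (suc k) F v eq = cong₂ _xor_ (eq zero) (sum-value k (F ∘ suc) v (eq ∘ suc))

  product-weight : ∀ k F w → weight w (product k F) ≡ sumFin k (λ i → weight w (F i))
  product-weight zero    F w = refl
  product-weight (suc k) F w = cong (weight w (F zero) +_) (product-weight k (F ∘ suc) w)

  sum-weight : ∀ k F w → weight w (sum k F) ≡ sumFin k (λ i → weight w (F i))
  sum-weight zero    F w = refl
  sum-weight (suc k) F w = cong (weight w (F zero) +_) (sum-weight k (F ∘ suc) w)

1≤size : ∀ {V} (F : Formula V) → 1 ≤ size F
1≤size (lit _ _)    = ≤-refl
1≤size (gate _ k c) = ≤-trans (1≤size (c zero)) (≤sumFin (suc k) (size ∘ c) zero)

fan-in≤size : ∀ {V} k (c : Fin k → Formula V) → k ≤ sumFin k (size ∘ c)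
fan-in≤size k c = sumFin≥ k (size ∘ c) (1≤size ∘ c)

weight-mono : ∀ {A : Set} {w w′ : A → ℕ} → (∀ a → w a ≤ w′ a) → ∀ F → weight w F ≤ weight w′ F
weight-mono le (leaf a)  = le a
weight-mono le (const b) = z≤n
weight-mono le (add F G) = +-mono-≤ (weight-mono le F) (weight-mono le G)
weight-mono le (mul F G) = +-mono-≤ (weight-mono le F) (weight-mono le G)

-- p = `suc x` is the smallest modulus, p + r the largest, and H = `suc h` the number of angle
-- positions. `resolution` and `range` are the hypotheses of the sign test at stage r; `leaves` says
-- that K rounds of splitting suffice.
record Parameters (s : ℕ) : Set where
  field
    r K x h P : ℕ
    resolution : 8 * (2 ^ r * (suc x + r)) ≤ suc h
    range      : 4 * r ! * s ≤ rising r (suc x)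
    moduli     : suc x + r ≤ suc P
    leaves     : 2 * suc r * s ≤ threshold r K

module Simulation (V : Set) {s : ℕ} (params : Parameters s) where
  open Parameters params

  Admissible : ℕ → Formula V → Set
  Admissible d F = majDepth F ≤ d × size F ≤ s

  child : ∀ {d t k} {c : Fin (suc k) → Formula V} → Admissible d (gate t k c) → ∀ i → Admissible d (c i)
  child {k = k} {c} (depth , small) i =
    ≤-trans (≤maxFin (suc k) (majDepth ∘ c) i) (≤-trans (m≤n+m _ _) depth) ,
    ≤-trans (≤sumFin (suc k) (size ∘ c) i) small

  majChild : ∀ {d k} {c : Fin (suc k) → Formula V} → Admissible (suc d) (gate MAJ k c) → ∀ i → Admissible d (c i)
  majChild {k = k} {c} (s≤s depth , small) i =
    ≤-trans (≤maxFin (suc k) (majDepth ∘ c) i) depth , ≤-trans (≤sumFin (suc k) (size ∘ c) i) small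

  data Test : Set where
    isPositive isUncertain : Test

  -- What the polynomial of a formula calls: literals, and single tests of its topmost majority
  -- gates. The children of such a gate are formulas one majority level lower, which makes recursion
  -- on the index possible.
  data Atom : ℕ → Set where
    literal : ∀ {d} → V → Bool → Atom d
    test    : ∀ {d} → Test → (m : ℕ) → m ≤ r → (k : ℕ) (c : Fin (suc k) → Formula V) →
              (∀ i → Admissible d (c i)) → Atom (suc d)

  stageAngle : ∀ k → (Fin (suc k) → Formula V) → (V → Bool) → ℕ → ℤ
  stageAngle k c ρ m = centre (suc h) (angles h (suc k) (countTrue (suc k) (λ i → eval (c i) ρ)) m x % suc h)

  outcome : Test → ℕ → ℤ → Bool
  outcome isPositive  = positive
  outcome isUncertain = uncertain

  atomValue : ∀ {d} → Atom d → (V → Bool) → Bool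
  atomValue (literal v b) ρ = eval (lit v b) ρ
  atomValue (test t m _ k c _) ρ = outcome t (2 ^ m) (stageAngle k c ρ m)

  -- A single test already has to evaluate all children of its gate, so it weighs as much as the
  -- whole gate.
  atomSize : ∀ {d} → Atom d → ℕ
  atomSize (literal _ _) = 1
  atomSize (test _ _ _ k c _) = sumFin (suc k) (size ∘ c)

  1≤atomSize : ∀ {d} (a : Atom d) → 1 ≤ atomSize a
  1≤atomSize (literal _ _) = ≤-refl
  1≤atomSize (test _ _ _ k c _) = ≤-trans (s≤s z≤n) (fan-in≤size (suc k) c)

  module _ {d} (k : ℕ) (c : Fin (suc k) → Formula V) (good : ∀ i → Admissible d (c i)) where

    stage : ∀ m → m ≤ r → Poly (Atom (suc d))
    below : ∀ m → m ≤ r → Poly (Atom (suc d))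
    stage m m≤r = add (leaf (test isPositive m m≤r k c good)) (mul (leaf (test isUncertain m m≤r k c good)) (below m m≤r))
    below zero    _    = const true
    below (suc m) m<r = stage m (≤-trans (n≤1+n m) m<r)

    stage-value : ∀ m m≤r ρ → ⟦ stage m m≤r ⟧ (λ a → atomValue a ρ) ≡ decide (stageAngle k c ρ) m
    stage-value zero    _   ρ = refl
    stage-value (suc m) m<r ρ = cong
      (λ b → positive (2 ^ suc m) (stageAngle k c ρ (suc m)) xor (uncertain (2 ^ suc m) (stageAngle k c ρ (suc m)) ∧ b))
      (stage-value m _ ρ)

    stage-weight : ∀ m m≤r → weight atomSize (stage m m≤r) ≡ 2 * suc m * sumFin (suc k) (size ∘ c)
    stage-weight zero    _   = arith (sumFin (suc k) (size ∘ c))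
      where arith : ∀ n → n + (n + 0) ≡ 2 * 1 * n
            arith = solve-∀
    stage-weight (suc m) m<r = trans (cong (λ t → w + (w + t)) (stage-weight m _)) (arith m w)
      where w = sumFin (suc k) (size ∘ c)
            arith : ∀ m n → n + (n + 2 * suc m * n) ≡ 2 * suc (suc m) * n
            arith = solve-∀

  toPoly : ∀ {d} (F : Formula V) → Admissible d F → Poly (Atom d)
  toPoly (lit v b)      _  = leaf (literal v b)
  toPoly (gate AND k c) ok = product (suc k) (λ i → toPoly (c i) (child {t = AND} {c = c} ok i))
  toPoly (gate OR k c)  ok = negate (product (suc k) (λ i → negate (toPoly (c i) (child {t = OR} {c = c} ok i))))
  toPoly (gate XOR k c) ok = sum (suc k) (λ i → toPoly (c i) (child {t = XOR} {c = c} ok i))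
  toPoly {suc d} (gate MAJ k c) ok = stage k c (majChild {c = c} ok) r ≤-refl

  majority-value : ∀ k (c : Fin (suc k) → Formula V) ρ → size (gate MAJ k c) ≤ s →
                   decide (stageAngle k c ρ) r ≡ eval (gate MAJ k c) ρ
  majority-value k c ρ small = trans
    (decide-correct (s≤s z≤n) (stageAngle k c ρ)
      (λ m → approx-centre (angles h (suc k) C m x) (approx-angles h (suc k) C m x))
      (λ m → centre≤ (suc h) _ (m%n<n (angles h (suc k) C m x) (suc h)))
      r resolution
      (≤-trans (*-monoʳ-≤ (4 * r !) (≤-trans (distance≤ C (suc k) (countTrue≤ (suc k) f))
                 (≤-trans (fan-in≤size (suc k) c) small))) range))
    (nonneg-threshold C (suc k))
    where
    f : Fin (suc k) → Bool
    f i = eval (c i) ρ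
    C = countTrue (suc k) f

  kids : ∀ {d k} t (c : Fin (suc k) → Formula V) → Admissible d (gate t k c) → Fin (suc k) → Poly (Atom d)
  kids t c ok i = toPoly (c i) (child {t = t} {c = c} ok i)

  toPoly-value : ∀ {d} F (ok : Admissible d F) ρ → ⟦ toPoly F ok ⟧ (λ a → atomValue a ρ) ≡ eval F ρ
  toPoly-value (lit v true)  ok ρ = refl
  toPoly-value (lit v false) ok ρ = refl
  toPoly-value (gate AND k c) ok ρ =
    trans (product-value (suc k) (kids AND c ok) _ {λ i → eval (c i) ρ} (λ i → toPoly-value (c i) (child {t = AND} {c = c} ok i) ρ))
          (sym (and-count (suc k) (λ i → eval (c i) ρ)))
  toPoly-value (gate OR k c) ok ρ =
    trans (cong not (product-value (suc k) (negate ∘ kids OR c ok) _ {λ i → not (eval (c i) ρ)}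
                      (λ i → cong not (toPoly-value (c i) (child {t = OR} {c = c} ok i) ρ))))
          (sym (or-count (suc k) (λ i → eval (c i) ρ)))
  toPoly-value (gate XOR k c) ok ρ =
    trans (sum-value (suc k) (kids XOR c ok) _ {λ i → eval (c i) ρ} (λ i → toPoly-value (c i) (child {t = XOR} {c = c} ok i) ρ))
          (sym (xor-count (suc k) (λ i → eval (c i) ρ)))
  toPoly-value {suc d} (gate MAJ k c) ok ρ =
    trans (stage-value k c (majChild {c = c} ok) r ≤-refl ρ) (majority-value k c ρ (proj₂ ok))

  -- A majority gate is replaced by r + 1 stages with two tests each; the other gates use every
  -- child once.
  toPoly-weight : ∀ {d} F (ok : Admissible d F) → weight atomSize (toPoly F ok) ≤ 2 * suc r * size F
  toPoly-weights : ∀ {d k} {c : Fin k → Formula V} (ok : ∀ i → Admissible d (c i)) →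
    sumFin k (λ i → weight atomSize (toPoly (c i) (ok i))) ≤ 2 * suc r * sumFin k (size ∘ c)

  toPoly-weight (lit v b) ok = s≤s z≤n
  toPoly-weight (gate AND k c) ok = ≤-trans (≤-reflexive (product-weight (suc k) (kids AND c ok) atomSize)) (toPoly-weights {c = c} (child {t = AND} {c = c} ok))
  toPoly-weight (gate OR k c) ok = ≤-trans (≤-reflexive (product-weight (suc k) (negate ∘ kids OR c ok) atomSize)) (toPoly-weights {c = c} (child {t = OR} {c = c} ok))
  toPoly-weight (gate XOR k c) ok = ≤-trans (≤-reflexive (sum-weight (suc k) (kids XOR c ok) atomSize)) (toPoly-weights {c = c} (child {t = XOR} {c = c} ok))
  toPoly-weight {suc d} (gate MAJ k c) ok = ≤-reflexive (stage-weight k c (majChild {c = c} ok) r ≤-refl)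

  toPoly-weights {k = k} {c} ok = ≤-trans (sumFin-≤ k (λ i → toPoly-weight (c i) (ok i))) (≤-reflexive (sumFin-* k (2 * suc r) (size ∘ c)))

  toPoly-leaves : ∀ {d} F (ok : Admissible d F) → leafCount (toPoly F ok) ≤ threshold r K
  toPoly-leaves F ok = ≤-trans (weight-mono 1≤atomSize (toPoly F ok))
    (≤-trans (toPoly-weight F ok) (≤-trans (*-monoʳ-≤ (2 * suc r) (proj₂ ok)) leaves))

  registers : ℕ
  registers = 4 + valueMuls r

  -- One majority level holds an angle, a counter and the registers for evaluating a child; all
  -- tests of the level share them. The registers of the outermost formula come on top.
  Workspace : ℕ → Set
  Workspace zero    = Bool
  Workspace (suc d) = Fin (suc h) × Fin (suc P) × Vec Bool registers × Workspace d

  -- Register 1 holds 1 and register 0 holds 0, so adding f times register 1 to register 0 leaves f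
  -- in register 0.
  seed : Vec Bool registers
  seed = unit (suc zero) true

  idle : ∀ d → Workspace d
  idle zero    = false
  idle (suc d) = zero , zero , seed , idle d

  atomCost formulaCost : ℕ → ℕ
  atomCost zero    = 1
  atomCost (suc d) = 4 * 2 ^ r * formulaCost d
  formulaCost d    = 8 ^ K * (2 * atomCost d * (2 * suc r))

  1≤atomCost : ∀ d → 1 ≤ atomCost d
  1≤atomCost zero    = ≤-refl
  1≤atomCost (suc d) = *-mono-≤ {1} {4 * 2 ^ r} (*-mono-≤ {1} {4} (s≤s z≤n) (m^n>0 2 r))
    (*-mono-≤ {1} {8 ^ K} (m^n>0 8 K) (*-mono-≤ {1} {2 * atomCost d} (*-mono-≤ {1} {2} (s≤s z≤n) (1≤atomCost d)) (s≤s z≤n)))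

  literalEvaluator : ∀ d v b → Evaluator (idle d) (eval {V} (lit v b)) 1
  literalEvaluator zero v b = record
    { prog = step v (λ c → if c then flip else ↔-refl) (done ↔-refl)
    ; out = if b then id else not
    ; correct = λ ρ → check b (ρ v) ρ refl
    ; bounded = ≤-refl }
    where
    flip : Bool ↔ Bool
    flip = mk↔ₛ′ not not not-involutive not-involutive
    check : ∀ b c ρ → ρ v ≡ c → (if b then id else not) (to (if ρ v then flip else ↔-refl) false) ≡ eval (lit v b) ρ
    check true  c ρ eq rewrite eq with c
    ... | true  = refl
    ... | false = refl
    check false c ρ eq rewrite eq with c
    ... | true  = refl
    ... | false = refl
  literalEvaluator (suc d) v b = withSpare zero (withSpare zero (withSpare seed (literalEvaluator d v b)))

  atomEvaluator : ∀ d (a : Atom d) → Evaluator (idle d) (atomValue a) (atomCost d * atomSize a)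
  formulaEvaluator : ∀ d (F : Formula V) → Admissible d F → Evaluator (seed , idle d) (eval F) (formulaCost d * size F)

  atomEvaluator d (literal v b) = reinterpret id (λ _ → refl) (*-mono-≤ (1≤atomCost d) ≤-refl) (literalEvaluator d v b)
  atomEvaluator (suc d) (test t m m≤r k c ok) = reinterpret (outcome t (2 ^ m)) (λ _ → refl) bound
    (centredAngle (λ i → formulaEvaluator d (c i) (ok i)) m x (≤-trans (+-monoʳ-≤ (suc x) m≤r) moduli))
    where
    arith : ∀ a b c → a * (4 * (b * c)) ≡ 4 * a * b * c
    arith = solve-∀
    bound : 2 ^ m * (4 * sumFin (suc k) (λ i → formulaCost d * size (c i))) ≤ 4 * 2 ^ r * formulaCost d * sumFin (suc k) (size ∘ c)
    bound = ≤-trans (*-mono-≤ (^-monoʳ-≤ 2 m≤r) (≤-reflexive (cong (4 *_) (sumFin-* (suc k) (formulaCost d) (size ∘ c)))))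
      (≤-reflexive (arith (2 ^ r) (formulaCost d) _))

  formulaEvaluator d F ok = reinterpret id readoff bound
    (evaluate seed (λ y → lookup y zero)
      (adds-bounded r atomValue (λ a → 2 * (atomCost d * atomSize a)) (λ a → adds (idle d) registers (atomEvaluator d a))
        K (toPoly F ok) (toPoly-leaves F ok) {zero} {suc zero} (λ ())))
    where
    readoff : ∀ ρ → lookup (addTo zero (suc zero) (⟦ toPoly F ok ⟧ (λ a → atomValue a ρ)) seed) zero ≡ eval F ρ
    readoff ρ = trans (addTo-target zero (suc zero) _ seed) (trans (∧-identityʳ _) (toPoly-value F ok ρ))
    arith : ∀ a b c d → a * (2 * b * (c * d)) ≡ a * (2 * b * c) * d
    arith = solve-∀
    bound : 8 ^ K * weight (λ a → 2 * (atomCost d * atomSize a)) (toPoly F ok) ≤ formulaCost d * size F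
    bound = begin
      8 ^ K * weight (λ a → 2 * (atomCost d * atomSize a)) (toPoly F ok)
        ≤⟨ *-monoʳ-≤ (8 ^ K) (weight-mono (λ a → ≤-reflexive (sym (*-assoc 2 (atomCost d) (atomSize a)))) (toPoly F ok)) ⟩
      8 ^ K * weight (λ a → 2 * atomCost d * atomSize a) (toPoly F ok)
        ≡⟨ cong (8 ^ K *_) (weight-scale (2 * atomCost d) atomSize (toPoly F ok)) ⟩
      8 ^ K * (2 * atomCost d * weight atomSize (toPoly F ok))
        ≤⟨ *-monoʳ-≤ (8 ^ K) (*-monoʳ-≤ (2 * atomCost d) (toPoly-weight F ok)) ⟩
      8 ^ K * (2 * atomCost d * (2 * suc r * size F))
        ≡⟨ arith (8 ^ K) (atomCost d) (2 * suc r) (size F) ⟩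
      formulaCost d * size F ∎
      where open ≤-Reasoning

-- Size estimates

sumFin-cong : ∀ k {f g : Fin k → ℕ} → (∀ i → f i ≡ g i) → sumFin k f ≡ sumFin k g
sumFin-cong zero    eq = refl
sumFin-cong (suc k) eq = cong₂ _+_ (eq zero) (sumFin-cong k (eq ∘ suc))

gateEval-cong : ∀ t k {f g : Fin k → Bool} → (∀ i → f i ≡ g i) → gateEval t k f ≡ gateEval t k g
gateEval-cong t k eq = gate-count t (sumFin-cong k (λ i → cong (if_then 1 else 0) (eq i)))
  where
  gate-count : ∀ t {f g} → countTrue k f ≡ countTrue k g → gateEval t k f ≡ gateEval t k g
  gate-count AND e rewrite e = refl
  gate-count OR  e rewrite e = refl
  gate-count XOR e rewrite e = refl
  gate-count MAJ e rewrite e = refl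

eval-cong : ∀ {V} (F : Formula V) {ρ ρ′ : V → Bool} → (∀ v → ρ v ≡ ρ′ v) → eval F ρ ≡ eval F ρ′
eval-cong (lit v true)  eq = eq v
eval-cong (lit v false) eq = cong not (eq v)
eval-cong (gate t k c)  eq = gateEval-cong t (suc k) (λ i → eval-cong (c i) eq)

pair : ∀ {A B : Set} {m n} → A ↔ Fin m → B ↔ Fin n → (A × B) ↔ Fin (m * n)
pair f g = ↔-trans (f ×-↔ g) (↔-sym *↔×)

bits : ∀ n → Vec Bool n ↔ Fin (2 ^ n)
bits zero    = mk↔ₛ′ (λ _ → zero) (λ _ → []) (λ { zero → refl }) (λ { [] → refl })
bits (suc n) = ↔-trans uncons (pair (↔-sym 2↔Bool) (bits n))
  where
  uncons : Vec Bool (suc n) ↔ (Bool × Vec Bool n)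
  uncons = mk↔ₛ′ (λ { (b ∷ v) → b , v }) (λ { (b , v) → b ∷ v }) (λ { (b , v) → refl }) (λ { (b ∷ v) → refl })

-- Rounding s up to a power of b loses at most one factor b, which is a constant for b = 2^r.
logarithm : ∀ {b} → 2 ≤ b → ∀ s → 1 ≤ s → Σ ℕ λ k → s ≤ b ^ k × b ^ k ≤ b * s
logarithm 2≤b (suc zero) _ = 0 , s≤s z≤n , *-mono-≤ (≤-trans (s≤s z≤n) 2≤b) (s≤s z≤n)
logarithm {b} 2≤b (suc s@(suc _)) _ with logarithm 2≤b s (s≤s z≤n)
... | k , lower , upper with suc s ≤? b ^ k
...   | yes le = k , le , ≤-trans upper (*-monoʳ-≤ b (n≤1+n s))
...   | no ≰ = suc k , ≤-trans 1+s≤2s (*-mono-≤ 2≤b lower) , *-monoʳ-≤ b (<⇒≤ (≰⇒> ≰))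
  where
  1+s≤2s : suc s ≤ 2 * s
  1+s≤2s = subst (suc s ≤_) (cong (s +_) (sym (+-identityʳ s))) (+-monoˡ-≤ s (s≤s z≤n))

^-distrib-* : ∀ k m n → (m * n) ^ k ≡ m ^ k * n ^ k
^-distrib-* zero    m n = refl
^-distrib-* (suc k) m n = trans (cong (m * n *_) (^-distrib-* k m n)) (arith m n (m ^ k) (n ^ k))
  where arith : ∀ m n a b → m * n * (a * b) ≡ m * a * (n * b)
        arith = solve-∀

suc≤2^ : ∀ r → suc r ≤ 2 ^ r
suc≤2^ zero    = ≤-refl
suc≤2^ (suc r) = ≤-trans (+-mono-≤ (m^n>0 2 r) (suc≤2^ r)) (+-monoʳ-≤ (2 ^ r) (m≤m+n _ 0))

doubled≡ : ∀ M r → doubled M r ≡ 2 ^ r * M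
doubled≡ M zero    = sym (+-identityʳ M)
doubled≡ M (suc r) = trans (cong₂ _+_ (doubled≡ M r) (doubled≡ M r)) (twice (2 ^ r) M)
  where twice : ∀ a b → a * b + a * b ≡ 2 * a * b
        twice = solve-∀

threshold≡ : ∀ r K → threshold r K ≡ (2 ^ r) ^ K
threshold≡ r zero    = refl
threshold≡ r (suc K) = trans (doubled≡ (threshold r K) r) (cong (2 ^ r *_) (threshold≡ r K))

^≤rising : ∀ m p → p ^ suc m ≤ rising m p
^≤rising zero    p = ≤-reflexive (*-identityʳ p)
^≤rising (suc m) p = ≤-trans (≤-reflexive (*-comm p _)) (*-mono-≤ (^≤rising m p) (m≤m+n p (suc m)))

module Bounds (r′ : ℕ) (k s : ℕ) (s≤ : s ≤ (2 ^ suc r′) ^ k) where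

  r L : ℕ
  r = suc r′
  L = 2 ^ k

  -- With p = 4 · r! · L, one factor p of p^(r+1) covers 4 · r! and the remaining p^r ≥ L^r covers
  -- s; this is the `range` condition.
  base : Σ ℕ λ x → suc x ≡ 4 * r ! * L
  base with 4 * r ! * L in eq
  ... | suc x = x , refl
  ... | zero  = ⊥-elim (n≮0 (subst (0 <_) eq (*-mono-< {0} {4 * r !} {0} (*-mono-< {0} {4} {0} (s≤s z≤n) (n!>0 r)) (m^n>0 2 k))))
    where
    n!>0 : ∀ n → 0 < n !
    n!>0 zero    = s≤s z≤n
    n!>0 (suc n) = *-mono-< {0} {suc n} {0} (s≤s z≤n) (n!>0 n)

  x = base .proj₁

  1≤L : 1 ≤ L
  1≤L = m^n>0 2 k

  params : Parameters s
  params = record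
    -- k rounds of splitting would do for s leaves; the two extra rounds absorb the factor 2 (r + 1)
    -- ≤ 2^r · 2^r from the stages.
    { r = r ; K = 2 + k ; x = x ; h = 8 * (2 ^ r * (suc x + r)) ; P = x + r
    ; resolution = n≤1+n _
    ; range = ≤-trans (*-mono-≤ {4 * r !} {suc x} 4r!≤ s≤x^r) (^≤rising r (suc x))
    ; moduli = ≤-refl
    ; leaves = ≤-trans (*-mono-≤ {2 * suc r} {2 ^ r * 2 ^ r} (*-mono-≤ {2} {2 ^ r} 2≤2^r (suc≤2^ r)) s≤)
        (≤-reflexive (trans (*-assoc (2 ^ r) (2 ^ r) _) (sym (threshold≡ r (2 + k))))) }
    where
    4r!≤ : 4 * r ! ≤ suc x
    4r!≤ = ≤-trans (m≤m*n (4 * r !) L ⦃ >-nonZero 1≤L ⦄) (≤-reflexive (sym (base .proj₂)))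
    L≤ : L ≤ suc x
    L≤ = ≤-trans (m≤n*m L (4 * r !) ⦃ m*n≢0 4 (r !) ⦃ _ ⦄ ⦃ r !≢0 ⦄ ⦄) (≤-reflexive (sym (base .proj₂)))
    s≤x^r : s ≤ suc x ^ r
    s≤x^r = ≤-trans s≤ (≤-trans (≤-reflexive (trans (^-*-assoc 2 r k) (trans (cong (2 ^_) (*-comm r k)) (sym (^-*-assoc 2 k r)))))
      (^-monoˡ-≤ r L≤))
    2≤2^r : 2 ≤ 2 ^ r
    2≤2^r = ≤-trans (s≤s (s≤s z≤n)) (suc≤2^ r)

  -- c₁ L and c₂ L bound the numbers of counter and angle positions, and σ is the constant factor
  -- per majority level. All four depend on r only.
  c₁ c₂ N σ : ℕ
  c₁ = 4 * r ! + r
  c₂ = 1 + 8 * (2 ^ r * c₁)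
  N  = 4 + valueMuls r
  σ  = 64 * (16 * 2 ^ r * suc r) * (c₂ * c₁ * 2 ^ N)

  module _ (V : Set) where
    open Simulation V params using (Workspace; formulaCost; atomCost)

    card : ℕ → ℕ
    card zero    = 2
    card (suc d) = suc (8 * (2 ^ r * (suc x + r))) * ((suc x + r) * (2 ^ N * card d))

    finite : ∀ d → Workspace d ↔ Fin (card d)
    finite zero    = ↔-sym 2↔Bool
    finite (suc d) = pair ↔-refl (pair ↔-refl (pair (bits N) (finite d)))

    P≤ : suc x + r ≤ c₁ * L
    P≤ = ≤-trans (+-mono-≤ (≤-reflexive (base .proj₂)) (m≤m*n r L ⦃ >-nonZero 1≤L ⦄)) (≤-reflexive (sym (*-distribʳ-+ L (4 * r !) r)))

    h≤ : suc (8 * (2 ^ r * (suc x + r))) ≤ c₂ * L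
    h≤ = ≤-trans (+-mono-≤ 1≤L (≤-trans (*-monoʳ-≤ 8 (*-monoʳ-≤ (2 ^ r) P≤)) (≤-reflexive (assoc (2 ^ r) c₁ L)))) ≤-refl
      where assoc : ∀ a b c → 8 * (a * (b * c)) ≡ 8 * (a * b) * c
            assoc = solve-∀

    8^ : 8 ^ (2 + k) ≡ 64 * L ^ 3
    8^ = trans (sym (*-assoc 8 8 (8 ^ k))) (cong (64 *_) (trans (^-*-assoc 2 3 k) (trans (cong (2 ^_) (*-comm 3 k)) (sym (^-*-assoc 2 k 3)))))

    -- Of the exponent 5, three come from `8 ^ (2 + k)` and one each from angle and counter; at
    -- depth 0 the latter two are slack.
    cost≤ : ∀ d → formulaCost d * card d ≤ (σ * L ^ 5) ^ suc d
    cost≤ zero = begin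
      8 ^ (2 + k) * (2 * 1 * (2 * suc r)) * 2 ≡⟨ cong (λ t → t * (2 * 1 * (2 * suc r)) * 2) 8^ ⟩
      64 * L ^ 3 * (2 * 1 * (2 * suc r)) * 2 ≡⟨ arith (L ^ 3) (suc r) ⟩
      64 * (8 * 1 * suc r) * 1 * (L ^ 3) ≤⟨ *-mono-≤ (*-mono-≤ (*-monoʳ-≤ 64 (*-monoˡ-≤ (suc r) (*-mono-≤ {8} {16} (s≤s (s≤s (s≤s (s≤s (s≤s (s≤s (s≤s (s≤s z≤n)))))))) (m^n>0 2 r))))
          (*-mono-≤ {1} {c₂ * c₁} (*-mono-≤ {1} {c₂} (s≤s z≤n) (≤-trans (s≤s z≤n) (m≤n+m r (4 * r !)))) (m^n>0 2 N)))
          (^-monoʳ-≤ L ⦃ >-nonZero 1≤L ⦄ {3} {5} (s≤s (s≤s (s≤s z≤n)))) ⟩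
      σ * L ^ 5 ≡⟨ sym (*-identityʳ _) ⟩
      (σ * L ^ 5) ^ 1 ∎
      where
      open ≤-Reasoning
      arith : ∀ y t → 64 * y * (2 * 1 * (2 * t)) * 2 ≡ 64 * (8 * 1 * t) * 1 * y
      arith = solve-∀
    cost≤ (suc d) = begin
      8 ^ (2 + k) * (2 * (4 * 2 ^ r * formulaCost d) * (2 * suc r)) * card (suc d)
        ≤⟨ *-mono-≤ (≤-reflexive (cong (_* (2 * (4 * 2 ^ r * formulaCost d) * (2 * suc r))) 8^))
             (*-mono-≤ h≤ (*-monoˡ-≤ (2 ^ N * card d) P≤)) ⟩
      64 * L ^ 3 * (2 * (4 * 2 ^ r * formulaCost d) * (2 * suc r)) * (c₂ * L * (c₁ * L * (2 ^ N * card d)))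
        ≡⟨ arith L (2 ^ r) (formulaCost d) (suc r) c₂ c₁ (2 ^ N) (card d) ⟩
      σ * L ^ 5 * (formulaCost d * card d)
        ≤⟨ *-monoʳ-≤ (σ * L ^ 5) (cost≤ d) ⟩
      (σ * L ^ 5) ^ suc (suc d) ∎
      where
      open ≤-Reasoning
      arith : ∀ y a f t c₂ c₁ n w →
        64 * (y * (y * (y * 1))) * (2 * (4 * a * f) * (2 * t)) * (c₂ * y * (c₁ * y * (n * w))) ≡
        64 * (16 * a * t) * (c₂ * c₁ * n) * (y * (y * (y * (y * (y * 1))))) * (f * w)
      arith = solve-∀

    1≤formulaCost : ∀ d → 1 ≤ formulaCost d
    1≤formulaCost d = *-mono-≤ {1} {8 ^ (2 + k)} (m^n>0 8 (2 + k))
      (*-mono-≤ {1} {2 * atomCost d} (*-mono-≤ {1} {2} (s≤s z≤n) (Simulation.1≤atomCost V params d)) (s≤s z≤n))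

    pipes≤ : ∀ d t → 1 ≤ t →
      suc (formulaCost d * t) * (2 * (2 ^ N * card d)) ≤ 4 * 2 ^ N * σ ^ suc d * ((L ^ 5) ^ suc d * t)
    pipes≤ d t 1≤t = begin
      suc (formulaCost d * t) * (2 * (2 ^ N * card d))
        ≤⟨ *-monoˡ-≤ (2 * (2 ^ N * card d)) (+-monoˡ-≤ (formulaCost d * t) (*-mono-≤ {1} {formulaCost d} (1≤formulaCost d) 1≤t)) ⟩
      (formulaCost d * t + formulaCost d * t) * (2 * (2 ^ N * card d)) ≡⟨ arith (formulaCost d) t (2 ^ N) (card d) ⟩
      4 * 2 ^ N * (formulaCost d * card d) * t ≤⟨ *-monoˡ-≤ t (*-monoʳ-≤ (4 * 2 ^ N) (cost≤ d)) ⟩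
      4 * 2 ^ N * (σ * L ^ 5) ^ suc d * t ≡⟨ cong (λ z → 4 * 2 ^ N * z * t) (^-distrib-* (suc d) σ (L ^ 5)) ⟩
      4 * 2 ^ N * (σ ^ suc d * (L ^ 5) ^ suc d) * t ≡⟨ assoc (4 * 2 ^ N) (σ ^ suc d) ((L ^ 5) ^ suc d) t ⟩
      4 * 2 ^ N * σ ^ suc d * ((L ^ 5) ^ suc d * t) ∎
      where
      open ≤-Reasoning
      arith : ∀ f t n c → (f * t + f * t) * (2 * (n * c)) ≡ 4 * n * (f * c) * t
      arith = solve-∀
      assoc : ∀ a b c t → a * (b * c) * t ≡ a * b * (c * t)
      assoc = solve-∀

-- Here ε = (p + 1) / (q + 1), with the denominator cleared by the power q + 1. It is enough to
-- reach the exponent 1 + 1 / (q + 1), because a formula has size at least 1.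
theorem5 : (d p q : ℕ) → Σ ℕ λ C →
    (a b : ℕ) (F : Formula (Fin a ⊎ Fin b)) → majDepth F ≤ d →
    Σ ℕ λ B → GH≤ (fun F) B × B ^ suc q ≤ C * size F ^ (suc q + suc p)
theorem5 d p q = κ ^ suc q * 2 ^ r , λ a b F depth →
  let s = size F
      k , s≤ , ≤s = logarithm {2 ^ r} (2≤2^suc r′) s (1≤size F)
      module X = Bounds r′ k s s≤
      open Simulation (Fin a ⊎ Fin b) X.params using (formulaCost; formulaEvaluator)
      GH = protocol (pair (bits X.N) (X.finite (Fin a ⊎ Fin b) d)) (formulaEvaluator d F (depth , ≤-refl))
  in suc (formulaCost d * s) * (2 * (2 ^ X.N * X.card (Fin a ⊎ Fin b) d)) ,
     transfer F GH ,
     power≤ s k (1≤size F) ≤s _ (X.pipes≤ (Fin a ⊎ Fin b) d s (1≤size F))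
  where
  -- 5 (d+1) (q+1), so that (L⁵)^((d+1)(q+1)) = (2^r)^k ≤ 2^r · s.
  r′ r κ : ℕ
  r′ = q + (4 * suc d + d) * suc q
  r  = suc r′
  -- This unfolds to the factor `4 * 2 ^ N * σ ^ suc d` of `pipes≤`. It is spelled out because
  -- `Bounds` takes k and s as parameters, while the constant has to be fixed before the formula.
  κ  = 4 * 2 ^ (4 + valueMuls r) * (64 * (16 * 2 ^ r * suc r) * ((1 + 8 * (2 ^ r * (4 * r ! + r))) * (4 * r ! + r) * 2 ^ (4 + valueMuls r))) ^ suc d

  2≤2^suc : ∀ m → 2 ≤ 2 ^ suc m
  2≤2^suc m = ≤-trans (s≤s (s≤s z≤n)) (suc≤2^ (suc m))

  transfer : ∀ {a b B} (F : Formula (Fin a ⊎ Fin b)) → GH≤ (λ x y → eval F [ x , y ]′) B → GH≤ (fun F) B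
  transfer F (s , s≤B , P , computes) = s , s≤B , P , λ x y →
    trans (computes x y) (eval-cong F λ { (inj₁ _) → refl ; (inj₂ _) → refl })

  exponent : ∀ k → (((2 ^ k) ^ 5) ^ suc d) ^ suc q ≡ (2 ^ r) ^ k
  exponent k = begin
    (((2 ^ k) ^ 5) ^ suc d) ^ suc q ≡⟨ cong (λ t → (t ^ suc d) ^ suc q) (^-*-assoc 2 k 5) ⟩
    ((2 ^ (k * 5)) ^ suc d) ^ suc q ≡⟨ cong (_^ suc q) (^-*-assoc 2 (k * 5) (suc d)) ⟩
    (2 ^ (k * 5 * suc d)) ^ suc q ≡⟨ ^-*-assoc 2 (k * 5 * suc d) (suc q) ⟩
    2 ^ (k * 5 * suc d * suc q) ≡⟨ cong (2 ^_) (arith k d q) ⟩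
    2 ^ (r * k) ≡⟨ sym (^-*-assoc 2 r k) ⟩
    (2 ^ r) ^ k ∎
    where
    open ≡-Reasoning
    arith : ∀ k d q → k * 5 * suc d * suc q ≡ suc (q + (4 * suc d + d) * suc q) * k
    arith = solve-∀

  power≤ : ∀ s k → 1 ≤ s → (2 ^ r) ^ k ≤ 2 ^ r * s → ∀ B → B ≤ κ * (((2 ^ k) ^ 5) ^ suc d * s) →
           B ^ suc q ≤ κ ^ suc q * 2 ^ r * s ^ (suc q + suc p)
  power≤ s k 1≤s ≤s B B≤ = begin
    B ^ suc q ≤⟨ ^-monoˡ-≤ (suc q) B≤ ⟩
    (κ * (G * s)) ^ suc q ≡⟨ trans (^-distrib-* (suc q) κ (G * s)) (cong (κ ^ suc q *_) (^-distrib-* (suc q) G s)) ⟩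
    κ ^ suc q * (G ^ suc q * s ^ suc q) ≤⟨ *-monoʳ-≤ (κ ^ suc q) (*-monoˡ-≤ (s ^ suc q) (≤-trans (≤-reflexive (exponent k)) ≤s)) ⟩
    κ ^ suc q * (2 ^ r * s * s ^ suc q) ≡⟨ arith (κ ^ suc q) (2 ^ r) (s * s ^ suc q) s (s ^ suc q) refl ⟩
    κ ^ suc q * 2 ^ r * s ^ suc (suc q) ≤⟨ *-monoʳ-≤ (κ ^ suc q * 2 ^ r) (^-monoʳ-≤ s ⦃ >-nonZero 1≤s ⦄
        (≤-trans (≤-reflexive (+-comm 1 (suc q))) (+-monoʳ-≤ (suc q) (s≤s (z≤n {p}))))) ⟩
    κ ^ suc q * 2 ^ r * s ^ (suc q + suc p) ∎
    where
    open ≤-Reasoning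
    G = ((2 ^ k) ^ 5) ^ suc d
    arith : ∀ a b c s t → c ≡ s * t → a * (b * s * t) ≡ a * b * c
    arith a b _ s t refl = trans (cong (a *_) (*-assoc b s t)) (sym (*-assoc a b (s * t)))
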